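{- Let $n$ be a positive integer, let $\varepsilon$ be a positive real number, and let $G$ be a connected non-complete graph with $t(G)\geq 1+\varepsilon$ and $|V(G)|\equiv n\pmod 2$. If $\kappa(G)>\frac{(n-2)(1+\varepsilon)}{\varepsilon}$, then $G$ is $n$-factor-critical.
   Context: All graphs are finite, simple and connected. $\kappa(G)$ denotes the vertex connectivity of $G$, and $c(H)$ denotes the number of connected components of a graph $H$. For a non-complete graph $G$, the toughness is $t(G)=\min \frac{|S|}{c(G-S)}$, the minimum taken over all vertex cut-sets $S\subset V(G)$ (sets $S$ for which $G-S$ is disconnected). A perfect matching is a set of pairwise vertex-disjoint edges covering all vertices. A graph $G$ with $|V(G)|\geq n+2$ and $|V(G)|\equiv n \pmod 2$ is called $n$-factor-critical if, after deleting any $n$ vertices from $G$, the remaining subgraph has a perfect matching. -}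

module Defs where

import Data.Bool.Properties as Bool
open import Data.Empty using (⊥-elim)
open import Data.Fin.Base using (Fin)
open import Data.Fin.Properties using (all?; any?) renaming (_≟_ to _≟ᶠ_)
open import Data.Fin.Subset
  using (Subset; inside; outside; _∈_; _∪_; ⁅_⁆; ∁; ⊤; ∣_∣)
open import Data.Fin.Subset.Properties
  using (_∈?_; ∣⊤∣≡n; ∣∁p∣≡n∸∣p∣; x∈⁅x⁆; x∈⁅y⁆⇒x≡y; x∈p∪q⁻;
         x∈p⇒x∉∁p; x∉p⇒x∈∁p; x∉∁p⇒x∈p; p⊆p∪q; q⊆p∪q)
open import Data.Integer.Base using (ℤ; +_)
open import Data.List.Base as List
  using (List; []; _∷_; _++_; filter; deduplicate; length; allFin)
open import Data.List.Extrema using (min)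
open import Data.List.Membership.Propositional renaming (_∈_ to _∈ₗ_)
open import Data.List.Membership.Propositional.Properties
  using (∈-allFin; ∈-filter⁺; ∈-map⁺; ∈-deduplicate⁺)
open import Data.List.Relation.Unary.All as All using (All)
open import Data.List.Relation.Unary.All.Properties using (all-filter)
open import Data.List.Relation.Unary.AllPairs using (AllPairs)
open import Data.List.Relation.Unary.Any using (Any; here; there)
open import Data.Nat.Base as ℕ using (ℕ; zero; suc; _%_)
import Data.Nat.Properties as ℕ
open import Data.Product.Base using (∃; ∃-syntax; _×_; _,_)
open import Data.Rational.Base as ℚ using (ℚ; 0ℚ; 1ℚ; ½)
import Data.Rational.Properties as ℚ
open import Data.Rational.Solver using (module +-*-Solver)
open import Data.Sum.Base using (_⊎_; inj₁; inj₂)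
open import Data.Vec.Base using (tabulate; []; _∷_)
open import Data.Vec.Properties using (≡-dec)
open import Level using (0ℓ)
open import Relation.Binary.Bundles using (TotalOrder; DecTotalOrder)
open import Relation.Binary.Construct.Closure.ReflexiveTransitive
  using (Star; ε; _◅_; _◅◅_)
open import Relation.Binary.Core using (Rel)
open import Relation.Binary.Definitions using (Decidable; Symmetric)
open import Relation.Binary.PropositionalEquality
open import Relation.Nullary using (¬_; Dec; yes; no; does; contradiction)
open import Relation.Nullary.Decidable
  using (map′; ¬?; _×-dec_; _⊎-dec_; _→-dec_; decidable-stable)
open import Relation.Unary as Unary using ()

-- Real numbers are Cauchy sequences of rationals. Two sequences with the same
-- limit are not identified; _<_ and _≤_ depend only on the limits.

Within : ℚ → (ℕ → ℚ) → ℕ → Set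
Within δ s N = ∀ m n → N ℕ.≤ m → N ℕ.≤ n → ℚ.∣ s m ℚ.- s n ∣ ℚ.< δ

IsCauchy : (ℕ → ℚ) → Set
IsCauchy s = ∀ δ → 0ℚ ℚ.< δ → ∃[ N ] Within δ s N

record ℝ : Set where
  constructor mkℝ
  field
    seq    : ℕ → ℚ
    cauchy : IsCauchy seq

open ℝ public

infix 4 _<_ _≤_ _>_ _≥_

_<_ _≤_ _>_ _≥_ : Rel ℝ 0ℓ
x < y = ∃[ δ ] 0ℚ ℚ.< δ × ∃[ N ] ∀ n → N ℕ.≤ n → seq x n ℚ.+ δ ℚ.≤ seq y n
x ≤ y = ¬ (y < x)
x > y = y < x
x ≥ y = y ≤ x

fromℚ : ℚ → ℝ
fromℚ q = mkℝ (λ _ → q) λ δ δ>0 → 0 , λ _ _ _ _ →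
  subst (ℚ._< δ) (sym (cong ℚ.∣_∣ (ℚ.+-inverseʳ q))) δ>0

fromℤ : ℤ → ℝ
fromℤ i = fromℚ (i ℚ./ 1)

fromℕ : ℕ → ℝ
fromℕ n = fromℤ (+ n)

0ℝ 1ℝ : ℝ
0ℝ = fromℚ 0ℚ
1ℝ = fromℚ 1ℚ

open +-*-Solver using (solve; _:+_; _:*_; _:-_; con; _:=_)

half>0 : ∀ {δ} → 0ℚ ℚ.< δ → 0ℚ ℚ.< ½ ℚ.* δ
half>0 = ℚ.*-monoʳ-<-pos ½

halves : ∀ δ → ½ ℚ.* δ ℚ.+ ½ ℚ.* δ ≡ δ
halves = solve 1 (λ d → con ½ :* d :+ con ½ :* d := d) refl

-- 1/p, extended by 0 at p = 0.
inv : ℚ → ℚ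
inv p with p ℚ.≟ 0ℚ
... | yes _   = 0ℚ
... | no p≢0 = (ℚ.1/ p) {{ℚ.≢-nonZero p≢0}}

*-inv : ∀ {p} → 0ℚ ℚ.< p → p ℚ.* inv p ≡ 1ℚ
*-inv {p} p>0 with p ℚ.≟ 0ℚ
... | yes p≡0 = contradiction (sym p≡0) (ℚ.<⇒≢ p>0)
... | no p≢0 = ℚ.*-inverseʳ p {{ℚ.≢-nonZero p≢0}}

inv>0 : ∀ {p} → 0ℚ ℚ.< p → 0ℚ ℚ.< inv p
inv>0 {p} p>0 = ℚ.*-cancelˡ-<-nonNeg p
  {{ℚ.nonNegative (ℚ.<⇒≤ p>0)}}
  (subst₂ ℚ._<_ (sym (ℚ.*-zeroʳ p)) (sym (*-inv p>0)) (ℚ.positive⁻¹ 1ℚ))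

*-pos : ∀ {p q} → 0ℚ ℚ.< p → 0ℚ ℚ.< q → 0ℚ ℚ.< p ℚ.* q
*-pos {p} {q} p>0 q>0 =
  subst (ℚ._< p ℚ.* q) (ℚ.*-zeroʳ p) (ℚ.*-monoʳ-<-pos p {{ℚ.positive p>0}} q>0)

*-diff : ∀ a b c d → a ℚ.* b ℚ.- c ℚ.* d ≡ a ℚ.* (b ℚ.- d) ℚ.+ d ℚ.* (a ℚ.- c)
*-diff = solve 4 (λ a b c d → a :* b :- c :* d := a :* (b :- d) :+ d :* (a :- c)) refl

+-diff : ∀ a b c d → (a ℚ.+ b) ℚ.- (c ℚ.+ d) ≡ (a ℚ.- c) ℚ.+ (b ℚ.- d)
+-diff = solve 4 (λ a b c d → (a :+ b) :- (c :+ d) := (a :- c) :+ (b :- d)) refl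

inv-diff : ∀ a b i j → (i ℚ.- j) ℚ.* (a ℚ.* b) ≡ b ℚ.* (a ℚ.* i) ℚ.- a ℚ.* (b ℚ.* j)
inv-diff = solve 4 (λ a b i j →
  (i :- j) :* (a :* b) := b :* (a :* i) :- a :* (b :* j)) refl

diff-+ : ∀ a b → a ≡ (a ℚ.- b) ℚ.+ b
diff-+ = solve 2 (λ a b → a := (a :- b) :+ b) refl

*-swap : ∀ p q r → p ℚ.* (q ℚ.* r) ≡ q ℚ.* (p ℚ.* r)
*-swap = solve 3 (λ p q r → p :* (q :* r) := q :* (p :* r)) refl

*-cancel-inv : ∀ {p} → 0ℚ ℚ.< p → ∀ q → p ℚ.* (q ℚ.* inv p) ≡ q
*-cancel-inv {p} p>0 q = begin
  p ℚ.* (q ℚ.* inv p)  ≡⟨ *-swap p q (inv p) ⟩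
  q ℚ.* (p ℚ.* inv p)  ≡⟨ cong (q ℚ.*_) (*-inv p>0) ⟩
  q ℚ.* 1ℚ             ≡⟨ ℚ.*-identityʳ q ⟩
  q                    ∎
  where open ≡-Reasoning

∣*-diff∣< : ∀ {A B δ₁ δ₂} a b c d → 0ℚ ℚ.< A → 0ℚ ℚ.< B →
  ℚ.∣ a ∣ ℚ.≤ A → ℚ.∣ d ∣ ℚ.≤ B → ℚ.∣ b ℚ.- d ∣ ℚ.< δ₁ → ℚ.∣ a ℚ.- c ∣ ℚ.< δ₂ →
  ℚ.∣ a ℚ.* b ℚ.- c ℚ.* d ∣ ℚ.< A ℚ.* δ₁ ℚ.+ B ℚ.* δ₂
∣*-diff∣< {A} {B} {δ₁} {δ₂} a b c d A>0 B>0 ∣a∣≤A ∣d∣≤B <δ₁ <δ₂ = begin-strict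
  ℚ.∣ a ℚ.* b ℚ.- c ℚ.* d ∣
    ≡⟨ cong ℚ.∣_∣ (*-diff a b c d) ⟩
  ℚ.∣ a ℚ.* (b ℚ.- d) ℚ.+ d ℚ.* (a ℚ.- c) ∣
    ≤⟨ ℚ.∣p+q∣≤∣p∣+∣q∣ (a ℚ.* (b ℚ.- d)) (d ℚ.* (a ℚ.- c)) ⟩
  ℚ.∣ a ℚ.* (b ℚ.- d) ∣ ℚ.+ ℚ.∣ d ℚ.* (a ℚ.- c) ∣
    ≡⟨ cong₂ ℚ._+_ (ℚ.∣p*q∣≡∣p∣*∣q∣ a (b ℚ.- d)) (ℚ.∣p*q∣≡∣p∣*∣q∣ d (a ℚ.- c)) ⟩
  ℚ.∣ a ∣ ℚ.* ℚ.∣ b ℚ.- d ∣ ℚ.+ ℚ.∣ d ∣ ℚ.* ℚ.∣ a ℚ.- c ∣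
    ≤⟨ ℚ.+-mono-≤
         (ℚ.*-monoʳ-≤-nonNeg ℚ.∣ b ℚ.- d ∣ {{ℚ.∣-∣-nonNeg (b ℚ.- d)}} ∣a∣≤A)
         (ℚ.*-monoʳ-≤-nonNeg ℚ.∣ a ℚ.- c ∣ {{ℚ.∣-∣-nonNeg (a ℚ.- c)}} ∣d∣≤B) ⟩
  A ℚ.* ℚ.∣ b ℚ.- d ∣ ℚ.+ B ℚ.* ℚ.∣ a ℚ.- c ∣
    <⟨ ℚ.+-mono-< (ℚ.*-monoʳ-<-pos A {{ℚ.positive A>0}} <δ₁)
                  (ℚ.*-monoʳ-<-pos B {{ℚ.positive B>0}} <δ₂) ⟩
  A ℚ.* δ₁ ℚ.+ B ℚ.* δ₂ ∎
  where open ℚ.≤-Reasoning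

∣inv-diff∣< : ∀ {c δ} a b → 0ℚ ℚ.< c → c ℚ.≤ a → c ℚ.≤ b →
  ℚ.∣ b ℚ.- a ∣ ℚ.< δ ℚ.* (c ℚ.* c) → ℚ.∣ inv a ℚ.- inv b ∣ ℚ.< δ
∣inv-diff∣< {c} {δ} a b c>0 c≤a c≤b <δcc =
  ℚ.*-cancelʳ-<-nonNeg (c ℚ.* c) {{ℚ.nonNegative (ℚ.<⇒≤ (*-pos c>0 c>0))}} (begin-strict
  ℚ.∣ d ∣ ℚ.* (c ℚ.* c)
    ≤⟨ ℚ.*-monoˡ-≤-nonNeg ℚ.∣ d ∣ {{ℚ.∣-∣-nonNeg d}} (ℚ.≤-trans
         (ℚ.*-monoʳ-≤-nonNeg c {{ℚ.nonNegative (ℚ.<⇒≤ c>0)}} c≤a)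
         (ℚ.*-monoˡ-≤-nonNeg a {{ℚ.nonNegative (ℚ.<⇒≤ a>0)}} c≤b)) ⟩
  ℚ.∣ d ∣ ℚ.* (a ℚ.* b)
    ≡⟨ cong (ℚ.∣ d ∣ ℚ.*_) (sym (ℚ.0≤p⇒∣p∣≡p (ℚ.<⇒≤ (*-pos a>0 b>0)))) ⟩
  ℚ.∣ d ∣ ℚ.* ℚ.∣ a ℚ.* b ∣
    ≡⟨ sym (ℚ.∣p*q∣≡∣p∣*∣q∣ d (a ℚ.* b)) ⟩
  ℚ.∣ d ℚ.* (a ℚ.* b) ∣
    ≡⟨ cong ℚ.∣_∣ (inv-diff a b (inv a) (inv b)) ⟩
  ℚ.∣ b ℚ.* (a ℚ.* inv a) ℚ.- a ℚ.* (b ℚ.* inv b) ∣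
    ≡⟨ cong₂ (λ p q → ℚ.∣ b ℚ.* p ℚ.- a ℚ.* q ∣) (*-inv a>0) (*-inv b>0) ⟩
  ℚ.∣ b ℚ.* 1ℚ ℚ.- a ℚ.* 1ℚ ∣
    ≡⟨ cong₂ (λ p q → ℚ.∣ p ℚ.- q ∣) (ℚ.*-identityʳ b) (ℚ.*-identityʳ a) ⟩
  ℚ.∣ b ℚ.- a ∣
    <⟨ <δcc ⟩
  δ ℚ.* (c ℚ.* c) ∎)
  where
  open ℚ.≤-Reasoning
  d   = inv a ℚ.- inv b
  a>0 = ℚ.<-≤-trans c>0 c≤a
  b>0 = ℚ.<-≤-trans c>0 c≤b

EventuallyBounded : ℝ → Set
EventuallyBounded x = ∃[ B ] 0ℚ ℚ.< B ×
  ∃[ N ] ∀ n → N ℕ.≤ n → ℚ.∣ seq x n ∣ ℚ.≤ B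

eventuallyBounded : ∀ x → EventuallyBounded x
eventuallyBounded x with cauchy x 1ℚ (ℚ.positive⁻¹ 1ℚ)
... | N , close = 1ℚ ℚ.+ ℚ.∣ seq x N ∣ ,
  ℚ.+-mono-<-≤ {0ℚ} {1ℚ} (ℚ.positive⁻¹ 1ℚ) (ℚ.0≤∣p∣ (seq x N)) ,
  N , λ n N≤n → begin
    ℚ.∣ seq x n ∣
      ≡⟨ cong ℚ.∣_∣ (diff-+ (seq x n) (seq x N)) ⟩
    ℚ.∣ (seq x n ℚ.- seq x N) ℚ.+ seq x N ∣
      ≤⟨ ℚ.∣p+q∣≤∣p∣+∣q∣ (seq x n ℚ.- seq x N) (seq x N) ⟩
    ℚ.∣ seq x n ℚ.- seq x N ∣ ℚ.+ ℚ.∣ seq x N ∣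
      ≤⟨ ℚ.+-monoˡ-≤ ℚ.∣ seq x N ∣ (ℚ.<⇒≤ (close n N N≤n ℕ.≤-refl)) ⟩
    1ℚ ℚ.+ ℚ.∣ seq x N ∣ ∎
  where open ℚ.≤-Reasoning

+-cauchy : ∀ x y → IsCauchy (λ n → seq x n ℚ.+ seq y n)
+-cauchy x y δ δ>0
  with cauchy x (½ ℚ.* δ) (half>0 δ>0) | cauchy y (½ ℚ.* δ) (half>0 δ>0)
... | M , closeˣ | N , closeʸ = M ℕ.⊔ N , λ m n M⊔N≤m M⊔N≤n → begin-strict
    ℚ.∣ (seq x m ℚ.+ seq y m) ℚ.- (seq x n ℚ.+ seq y n) ∣
      ≡⟨ cong ℚ.∣_∣ (+-diff (seq x m) (seq y m) (seq x n) (seq y n)) ⟩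
    ℚ.∣ (seq x m ℚ.- seq x n) ℚ.+ (seq y m ℚ.- seq y n) ∣
      ≤⟨ ℚ.∣p+q∣≤∣p∣+∣q∣ (seq x m ℚ.- seq x n) (seq y m ℚ.- seq y n) ⟩
    ℚ.∣ seq x m ℚ.- seq x n ∣ ℚ.+ ℚ.∣ seq y m ℚ.- seq y n ∣
      <⟨ ℚ.+-mono-<
           (closeˣ m n (ℕ.m⊔n≤o⇒m≤o M N M⊔N≤m) (ℕ.m⊔n≤o⇒m≤o M N M⊔N≤n))
           (closeʸ m n (ℕ.m⊔n≤o⇒n≤o M N M⊔N≤m) (ℕ.m⊔n≤o⇒n≤o M N M⊔N≤n)) ⟩
    ½ ℚ.* δ ℚ.+ ½ ℚ.* δ
      ≡⟨ halves δ ⟩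
    δ ∎
  where open ℚ.≤-Reasoning

*-within : ∀ {A B δ₁ δ₂ K L M N} (s t : ℕ → ℚ) → 0ℚ ℚ.< A → 0ℚ ℚ.< B →
  (∀ n → K ℕ.≤ n → ℚ.∣ s n ∣ ℚ.≤ A) → (∀ n → L ℕ.≤ n → ℚ.∣ t n ∣ ℚ.≤ B) →
  Within δ₂ s M → Within δ₁ t N →
  Within (A ℚ.* δ₁ ℚ.+ B ℚ.* δ₂) (λ n → s n ℚ.* t n) (K ℕ.⊔ L ℕ.⊔ (M ℕ.⊔ N))
*-within {K = K} {L} {M} {N} s t A>0 B>0 ∣s∣≤A ∣t∣≤B closeˢ closeᵗ m n ≤m ≤n =
  ∣*-diff∣< (s m) (t m) (s n) (t n) A>0 B>0
    (∣s∣≤A m (ℕ.m⊔n≤o⇒m≤o K L (ℕ.m⊔n≤o⇒m≤o (K ℕ.⊔ L) (M ℕ.⊔ N) ≤m)))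
    (∣t∣≤B n (ℕ.m⊔n≤o⇒n≤o K L (ℕ.m⊔n≤o⇒m≤o (K ℕ.⊔ L) (M ℕ.⊔ N) ≤n)))
    (closeᵗ m n (ℕ.m⊔n≤o⇒n≤o M N MN≤m) (ℕ.m⊔n≤o⇒n≤o M N MN≤n))
    (closeˢ m n (ℕ.m⊔n≤o⇒m≤o M N MN≤m) (ℕ.m⊔n≤o⇒m≤o M N MN≤n))
  where
  MN≤m = ℕ.m⊔n≤o⇒n≤o (K ℕ.⊔ L) (M ℕ.⊔ N) ≤m
  MN≤n = ℕ.m⊔n≤o⇒n≤o (K ℕ.⊔ L) (M ℕ.⊔ N) ≤n

*-cauchy : ∀ x y → IsCauchy (λ n → seq x n ℚ.* seq y n)
*-cauchy x y δ δ>0 = combine (eventuallyBounded x) (eventuallyBounded y)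
  where
  combine : EventuallyBounded x → EventuallyBounded y → ∃ (Within δ (λ n → seq x n ℚ.* seq y n))
  combine (A , A>0 , K , ∣x∣≤A) (B , B>0 , L , ∣y∣≤B) =
    conclude (cauchy x (½ ℚ.* δ ℚ.* inv B) (*-pos (half>0 δ>0) (inv>0 B>0)))
             (cauchy y (½ ℚ.* δ ℚ.* inv A) (*-pos (half>0 δ>0) (inv>0 A>0)))
    where
    total : A ℚ.* (½ ℚ.* δ ℚ.* inv A) ℚ.+ B ℚ.* (½ ℚ.* δ ℚ.* inv B) ≡ δ
    total = trans
      (cong₂ ℚ._+_ (*-cancel-inv A>0 (½ ℚ.* δ)) (*-cancel-inv B>0 (½ ℚ.* δ)))
      (halves δ)

    conclude : ∃ (Within (½ ℚ.* δ ℚ.* inv B) (seq x)) →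
               ∃ (Within (½ ℚ.* δ ℚ.* inv A) (seq y)) →
               ∃ (Within δ (λ n → seq x n ℚ.* seq y n))
    conclude (M , closeˣ) (N , closeʸ) = K ℕ.⊔ L ℕ.⊔ (M ℕ.⊔ N) ,
      subst (λ d → Within d (λ n → seq x n ℚ.* seq y n) (K ℕ.⊔ L ℕ.⊔ (M ℕ.⊔ N))) total
        (*-within (seq x) (seq y) A>0 B>0 ∣x∣≤A ∣y∣≤B closeˣ closeʸ)

inv-cauchy : ∀ x → 0ℝ < x → IsCauchy (λ n → inv (seq x n))
inv-cauchy x (c , c>0 , K , c≤x) δ δ>0
  with cauchy x (δ ℚ.* (c ℚ.* c)) (*-pos δ>0 (*-pos c>0 c>0))
... | N , close = K ℕ.⊔ N , λ m n ≤m ≤n →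
  ∣inv-diff∣< (seq x m) (seq x n) c>0
    (subst (ℚ._≤ seq x m) (ℚ.+-identityˡ c) (c≤x m (ℕ.m⊔n≤o⇒m≤o K N ≤m)))
    (subst (ℚ._≤ seq x n) (ℚ.+-identityˡ c) (c≤x n (ℕ.m⊔n≤o⇒m≤o K N ≤n)))
    (close n m (ℕ.m⊔n≤o⇒n≤o K N ≤n) (ℕ.m⊔n≤o⇒n≤o K N ≤m))

infixl 6 _+_
infixl 7 _*_ _/_⟨_⟩

_+_ _*_ : ℝ → ℝ → ℝ
x + y = mkℝ (λ n → seq x n ℚ.+ seq y n) (+-cauchy x y)
x * y = mkℝ (λ n → seq x n ℚ.* seq y n) (*-cauchy x y)

_/_⟨_⟩ : ℝ → (y : ℝ) → 0ℝ < y → ℝ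
x / y ⟨ y>0 ⟩ = x * mkℝ (λ n → inv (seq y n)) (inv-cauchy y y>0)

subsets : ∀ n → List (Subset n)
subsets zero    = [] ∷ []
subsets (suc n) =
  List.map (outside ∷_) (subsets n) ++ List.map (inside ∷_) (subsets n)

-- The minimum of f over all subsets satisfying P; the argument of type
-- ∃ P only witnesses that there is one.
minimum : ∀ {b ℓ₁ ℓ₂} (O : TotalOrder b ℓ₁ ℓ₂) {n} {P : Subset n → Set} →
          Unary.Decidable P → (∃ P → TotalOrder.Carrier O) → ∃ P →
          TotalOrder.Carrier O
minimum O {n} P? f S₀ =
  min O (f S₀) (List.map f (All.toList (all-filter P? (subsets n))))

-- Warshall's algorithm, deciding reachability in a finite relation.
module _ {n} {R : Rel (Fin n) 0ℓ} (R? : Decidable R) where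

  private
    -- There is a walk all of whose inner vertices are in the list.
    Via : List (Fin n) → Rel (Fin n) 0ℓ
    Via []       u v = u ≡ v ⊎ R u v
    Via (w ∷ ws) u v = Via ws u v ⊎ (Via ws u w × Via ws w v)

    via? : ∀ ws → Decidable (Via ws)
    via? []       u v = (u ≟ᶠ v) ⊎-dec R? u v
    via? (w ∷ ws) u v = via? ws u v ⊎-dec (via? ws u w ×-dec via? ws w v)

    via⇒star : ∀ ws {u v} → Via ws u v → Star R u v
    via⇒star []       (inj₁ refl)    = ε
    via⇒star []       (inj₂ r)       = r ◅ ε
    via⇒star (w ∷ ws) (inj₁ p)       = via⇒star ws p
    via⇒star (w ∷ ws) (inj₂ (p , q)) = via⇒star ws p ◅◅ via⇒star ws q

    base : ∀ ws {u v} → u ≡ v ⊎ R u v → Via ws u v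
    base []       r = r
    base (w ∷ ws) r = inj₁ (base ws r)

    join : ∀ {ws x u v} → x ∈ₗ ws → Via ws u x → Via ws x v → Via ws u v
    join (here refl) p q = inj₂ (to p , from q)
      where
      to : ∀ {A B : Set} → A ⊎ (A × B) → A
      to (inj₁ a)       = a
      to (inj₂ (a , _)) = a
      from : ∀ {A B : Set} → B ⊎ (A × B) → B
      from (inj₁ b)       = b
      from (inj₂ (_ , b)) = b
    join (there x∈ws) (inj₁ p)       (inj₁ q)       = inj₁ (join x∈ws p q)
    join (there x∈ws) (inj₁ p)       (inj₂ (q , r)) = inj₂ (join x∈ws p q , r)
    join (there x∈ws) (inj₂ (p , q)) (inj₁ r)       = inj₂ (p , join x∈ws q r)
    join (there x∈ws) (inj₂ (p , _)) (inj₂ (_ , r)) = inj₂ (p , r)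

    star⇒via : ∀ {u v} → Star R u v → Via (allFin n) u v
    star⇒via ε                = base (allFin n) (inj₁ refl)
    star⇒via (_◅_ {j = w} r s) =
      join (∈-allFin w) (base (allFin n) (inj₂ r)) (star⇒via s)

  star? : Decidable (Star R)
  star? u v = map′ (via⇒star (allFin n)) star⇒via (via? (allFin n) u v)

record Graph : Set₁ where
  field
    order  : ℕ
    Adj    : Rel (Fin order) 0ℓ
    adj?   : Decidable Adj
    symm   : Symmetric Adj
    irrefl : ∀ {v} → ¬ Adj v v

open Graph public

Complete : Graph → Set
Complete G = ∀ u v → u ≢ v → Adj G u v

-- A vertex set W stands for the subgraph of G induced on W, so that G − S
-- is represented by ∁ S, and G itself by ⊤.
module Induced (G : Graph) (W : Subset (order G)) where

  Edge : Rel (Fin (order G)) 0ℓ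
  Edge u v = u ∈ W × v ∈ W × Adj G u v

  edge? : Decidable Edge
  edge? u v = (u ∈? W) ×-dec (v ∈? W) ×-dec adj? G u v

  Reachable : Rel (Fin (order G)) 0ℓ
  Reachable = Star Edge

  IsConnected : Set
  IsConnected = ∀ u v → u ∈ W → v ∈ W → Reachable u v

  isConnected? : Dec IsConnected
  isConnected? = all? λ u → all? λ v →
    (u ∈? W) →-dec ((v ∈? W) →-dec star? edge? u v)

  -- The vertex set of the component containing v, for v ∈ W.
  component : Fin (order G) → Subset (order G)
  component v = tabulate λ u → does (star? edge? v u)

  components : List (Subset (order G))
  components = deduplicate (≡-dec Bool._≟_)
    (List.map component (filter (_∈? W) (allFin (order G))))

  #components : ℕ
  #components = length components

  Incident : Fin (order G) → Fin (order G) × Fin (order G) → Set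
  Incident x (u , v) = x ≡ u ⊎ x ≡ v

  Disjoint : Rel (Fin (order G) × Fin (order G)) 0ℓ
  Disjoint e f = ∀ x → ¬ (Incident x e × Incident x f)

  record PerfectMatching : Set where
    field
      edges    : List (Fin (order G) × Fin (order G))
      areEdges : All (λ (u , v) → Edge u v) edges
      disjoint : AllPairs Disjoint edges
      covers   : ∀ x → x ∈ W → Any (Incident x) edges

  disconnected⇒#components≢0 : ¬ IsConnected → ℕ.NonZero #components
  disconnected⇒#components≢0 ¬conn = ℕ.≢-nonZero λ c≡0 →
    ¬conn λ u _ u∈W _ → contradiction c≡0 (nonempty (∈-deduplicate⁺ (≡-dec Bool._≟_)
      (∈-map⁺ component (∈-filter⁺ (_∈? W) (∈-allFin u) u∈W))))
    where
    nonempty : ∀ {C} {Cs : List (Subset (order G))} → C ∈ₗ Cs → length Cs ≢ 0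
    nonempty (here _)  ()
    nonempty (there _) ()

module _ (G : Graph) where

  open Induced G

  Connected : Set
  Connected = IsConnected ⊤

  CutSet : Subset (order G) → Set
  CutSet S = ¬ IsConnected (∁ S)

  cutSet? : Unary.Decidable CutSet
  cutSet? S = ¬? (isConnected? (∁ S))

  nonComplete⇒cutSet : ¬ Complete G → ∃ CutSet
  nonComplete⇒cutSet ¬complete
    with any? (λ u → any? λ v → ¬? (u ≟ᶠ v) ×-dec ¬? (adj? G u v))
  ... | no none = ⊥-elim (¬complete λ u v u≢v →
          decidable-stable (adj? G u v) λ ¬uv → none (u , v , u≢v , ¬uv))
  ... | yes (u , v , u≢v , ¬uv) = ∁ pair , λ conn →
          stuck (conn u v (inPair (p⊆p∪q ⁅ v ⁆ (x∈⁅x⁆ u)))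
                          (inPair (q⊆p∪q ⁅ u ⁆ ⁅ v ⁆ (x∈⁅x⁆ v))))
    where
    pair = ⁅ u ⁆ ∪ ⁅ v ⁆
    inPair : ∀ {x} → x ∈ pair → x ∈ ∁ (∁ pair)
    inPair x∈ = x∉p⇒x∈∁p (x∈p⇒x∉∁p x∈)
    stuck : ¬ Reachable (∁ (∁ pair)) u v
    stuck ε = u≢v refl
    stuck (_◅_ {j = w} (_ , w∈ , uw) _)
      with x∈p∪q⁻ ⁅ u ⁆ ⁅ v ⁆ (x∉∁p⇒x∈p λ w∈′ → x∈p⇒x∉∁p w∈′ w∈)
    ... | inj₁ w∈u = irrefl G (subst (Adj G u) (x∈⁅y⁆⇒x≡y u w∈u) uw)
    ... | inj₂ w∈v = ¬uv (subst (Adj G u) (x∈⁅y⁆⇒x≡y v w∈v) uw)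

  ratio : ∃ CutSet → ℚ
  ratio (S , cut) = (+ ∣ S ∣ ℚ./ #components (∁ S))
    {{disconnected⇒#components≢0 (∁ S) cut}}

  toughness : ¬ Complete G → ℚ
  toughness nc = minimum (DecTotalOrder.totalOrder ℚ.≤-decTotalOrder)
    cutSet? ratio (nonComplete⇒cutSet nc)

  -- At most one vertex remaining counts as separated, so that κ G is also
  -- defined for complete G, with κ (K m) = m ∸ 1.
  Separates : Subset (order G) → Set
  Separates S = CutSet S ⊎ ∣ ∁ S ∣ ℕ.≤ 1

  separates? : Unary.Decidable Separates
  separates? S = cutSet? S ⊎-dec (∣ ∁ S ∣ ℕ.≤? 1)

  κ : ℕ
  κ = minimum ℕ.≤-totalOrder separates? (λ (S , _) → ∣ S ∣) (⊤ , inj₂ small)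
    where
    small : ∣ ∁ (⊤ {order G}) ∣ ℕ.≤ 1
    small = ℕ.≤-trans (ℕ.≤-reflexive (trans (∣∁p∣≡n∸∣p∣ (⊤ {order G}))
      (trans (cong (order G ℕ.∸_) (∣⊤∣≡n (order G))) (ℕ.n∸n≡0 (order G))))) ℕ.z≤n

  FactorCritical : ℕ → Set
  FactorCritical n =
    n ℕ.+ 2 ℕ.≤ order G ×
    order G % 2 ≡ n % 2 ×
    (∀ S → ∣ S ∣ ≡ n → PerfectMatching (∁ S))

{-# OPTIONS --safe #-}

-- The Tutte–Berge theorem is needed only with components in place of odd
-- components. If a maximum matching f of an induced subgraph W is not perfect
-- and some vertex is covered by every maximum matching, delete it; otherwise
-- Gallai's lemma says that no two vertices missed by f lie in one component.
-- Applied to W = G − S with ∣ S ∣ = n, of even order, this turns a missing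
-- perfect matching into a cut set T with ∣ T ∣ + 2 ≤ c + n, c = c(G − T).
-- As κ ≤ ∣ T ∣, the bound κ ε > (n − 2)(1 + ε) ≥ (∣ T ∣ − c)(1 + ε) gives
-- ∣ T ∣ < c (1 + ε), against t(G) ≥ 1 + ε.
module Submission where

open import Defs
import Data.Bool.Properties as Bool
open import Data.Bool.Base using (true)
open import Data.Empty using (⊥)
open import Data.Fin.Base using (Fin; zero; suc)
open import Data.Fin.Properties using (all?; any?) renaming (_≟_ to _≟ᶠ_)
open import Data.Fin.Subset hiding (⊥)
open import Data.Fin.Subset.Properties
open import Data.Integer.Base as ℤ using (+_)
import Data.Integer.Properties as ℤ
import Data.Integer.Solver as ℤ
open import Data.List.Base as List using (List; []; _∷_; _++_; length)
open import Data.List.Extrema using (min; min≤xs)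
open import Data.List.Membership.Propositional using () renaming (_∈_ to _∈ₗ_)
open import Data.List.Membership.Propositional.Properties
  using (∈-∃++; ∈-++⁻; ∈-++⁺ˡ; ∈-++⁺ʳ; ∈-map⁺; ∈-filter⁺; ∈-allFin; ∈-deduplicate⁺)
import Data.List.Properties as List
open import Data.List.Relation.Unary.All as All using (All; []; _∷_)
import Data.List.Relation.Unary.All.Properties as All
open import Data.List.Relation.Unary.AllPairs as AllPairs using (AllPairs; []; _∷_)
import Data.List.Relation.Unary.AllPairs.Properties as AllPairs
open import Data.List.Relation.Unary.Any using (Any; here; there)
open import Data.List.Relation.Unary.Unique.Propositional using (Unique)
open import Data.Nat.Base as ℕ using (ℕ; zero; suc; _%_; z≤n; s≤s)
open import Data.Nat.Induction using (<-wellFounded)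
import Data.Nat.Properties as ℕ
open import Data.Nat.Solver using (module +-*-Solver)
open import Data.Product.Base using (∃; ∃-syntax; _×_; _,_; proj₁; proj₂)
open import Data.Rational.Base as ℚ using (ℚ; 0ℚ; 1ℚ; toℚᵘ)
import Data.Rational.Properties as ℚ
open import Data.Rational.Solver using () renaming (module +-*-Solver to ℚSolver)
open import Data.Rational.Unnormalised.Base as ℚᵘ using (mkℚᵘ; *≡*; *≤*)
import Data.Rational.Unnormalised.Properties as ℚᵘ
open import Data.Sum.Base using (_⊎_; inj₁; inj₂; [_,_]′)
open import Data.Vec.Base as Vec using (Vec; []; _∷_; tabulate; lookup)
open import Data.Vec.Properties
  using (lookup∘tabulate; tabulate-cong; []=⇒lookup; lookup⇒[]=; ≡-dec)
open import Function.Base using (_∘_; id)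
open import Induction.WellFounded using (Acc; acc)
open import Relation.Binary.Bundles using (TotalOrder; DecTotalOrder)
open import Relation.Binary.Construct.Closure.ReflexiveTransitive as Star using (_◅_)
open import Relation.Binary.PropositionalEquality
open import Relation.Nullary using (¬_; Dec; yes; no; does; contradiction)
open import Relation.Nullary.Decidable
  using (map′; ¬?; _×-dec_; _→-dec_; dec-true; decidable-stable)
open import Relation.Unary using (Decidable)

-- Counting in finite subsets and lists.

module _ {n} {P : Fin n → Set} (P? : Decidable P) where

  ∈-tabulate⁺ : ∀ {x} → P x → x ∈ tabulate (does ∘ P?)
  ∈-tabulate⁺ {x} px =
    lookup⇒[]= x _ (trans (lookup∘tabulate (does ∘ P?) x) (dec-true (P? x) px))

  ∈-tabulate⁻ : ∀ {x} → x ∈ tabulate (does ∘ P?) → P x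
  ∈-tabulate⁻ {x} x∈ = witness (P? x)
    (trans (sym (lookup∘tabulate (does ∘ P?) x)) ([]=⇒lookup x∈))
    where
    witness : ∀ {A : Set} (a? : Dec A) → does a? ≡ true → A
    witness (yes a) _ = a

x∈p⇒1+∣p-x∣≡∣p∣ : ∀ {n} {p : Subset n} {x} → x ∈ p → suc ∣ p - x ∣ ≡ ∣ p ∣
x∈p⇒1+∣p-x∣≡∣p∣ {p = inside ∷ p}  Vec.here = cong (suc ∘ ∣_∣) (p─⊥≡p p)
x∈p⇒1+∣p-x∣≡∣p∣ {p = inside ∷ p}  (Vec.there x∈p) = cong suc (x∈p⇒1+∣p-x∣≡∣p∣ x∈p)
x∈p⇒1+∣p-x∣≡∣p∣ {p = outside ∷ p} (Vec.there x∈p) = x∈p⇒1+∣p-x∣≡∣p∣ x∈p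

x∈p-y⁻ : ∀ {n} {p : Subset n} {x y} → x ∈ p - y → x ∈ p × x ≢ y
x∈p-y⁻ {p = p} {x} {y} x∈ = p─q⊆p p ⁅ y ⁆ x∈ , λ { refl →
  -- If `x` were in `p - x`, deleting it again would strictly shrink `p - x`, yet deletion is
  -- idempotent.
  ℕ.<-irrefl (cong ∣_∣ (p─q─q≡p─q p ⁅ x ⁆)) (x∈p⇒∣p-x∣<∣p∣ x∈) }

elements : ∀ {n} (p : Subset n) →
  ∃[ xs ] Unique xs × All (_∈ p) xs × length xs ≡ ∣ p ∣
elements [] = [] , [] , [] , refl
elements (s ∷ p) with elements p
elements (outside ∷ p) | xs , uniq , xs⊆p , ∣xs∣ =
  List.map suc xs ,
  AllPairs.map⁺ (AllPairs.map (λ x≢y → λ { refl → x≢y refl }) uniq) ,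
  All.map⁺ (All.map Vec.there xs⊆p) ,
  trans (List.length-map suc xs) ∣xs∣
elements (inside ∷ p) | xs , uniq , xs⊆p , ∣xs∣ =
  zero ∷ List.map suc xs ,
  All.map⁺ (All.universal (λ _ ()) xs) ∷
    AllPairs.map⁺ (AllPairs.map (λ x≢y → λ { refl → x≢y refl }) uniq) ,
  Vec.here ∷ All.map⁺ (All.map Vec.there xs⊆p) ,
  cong suc (trans (List.length-map suc xs) ∣xs∣)

allPairs-zip : ∀ {A : Set} {P : A → Set} {R S : A → A → Set} →
  (∀ {x y} → P x → P y → R x y → S x y) →
  ∀ {xs} → All P xs → AllPairs R xs → AllPairs S xs
allPairs-zip f []         []         = []
allPairs-zip f (px ∷ pxs) (rx ∷ rxs) =
  All.zipWith (λ (py , r) → f px py r) (pxs , rx) ∷ allPairs-zip f pxs rxs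

unique⊆⇒length≤ : ∀ {A : Set} {xs ys : List A} →
  Unique xs → All (_∈ₗ ys) xs → length xs ℕ.≤ length ys
unique⊆⇒length≤ [] [] = z≤n
unique⊆⇒length≤ {xs = x ∷ xs} (x∉xs ∷ uniq) (x∈ys ∷ xs⊆ys) with ∈-∃++ x∈ys
... | as , bs , refl = subst (suc (length xs) ℕ.≤_) (sym length-middle)
    (s≤s (unique⊆⇒length≤ uniq (All.zipWith skip (x∉xs , xs⊆ys))))
  where
  length-middle : length (as ++ x ∷ bs) ≡ suc (length (as ++ bs))
  length-middle = trans (List.length-++ as) (trans (ℕ.+-suc (length as) (length bs))
    (cong suc (sym (List.length-++ as))))
  skip : ∀ {y} → x ≢ y × y ∈ₗ as ++ x ∷ bs → y ∈ₗ as ++ bs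
  skip (x≢y , y∈) with ∈-++⁻ as y∈
  ... | inj₁ y∈as         = ∈-++⁺ˡ y∈as
  ... | inj₂ (here refl)  = contradiction refl x≢y
  ... | inj₂ (there y∈bs) = ∈-++⁺ʳ as y∈bs

anyVec? : ∀ {m k} {P : Vec (Fin m) k → Set} → Decidable P → Dec (∃ P)
anyVec? {k = zero}  P? = map′ ([] ,_) (λ { ([] , p) → p }) (P? [])
anyVec? {k = suc k} P? = map′ (λ (x , xs , p) → x ∷ xs , p) (λ { (x ∷ xs , p) → x , xs , p })
  (any? λ x → anyVec? (P? ∘ (x ∷_)))

∣p∣≤∣p∩∁q∣+∣q∣ : ∀ {n} (p q : Subset n) → ∣ p ∣ ℕ.≤ ∣ p ∩ ∁ q ∣ ℕ.+ ∣ q ∣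
∣p∣≤∣p∩∁q∣+∣q∣ [] [] = z≤n
∣p∣≤∣p∩∁q∣+∣q∣ (outside ∷ p) (outside ∷ q) = ∣p∣≤∣p∩∁q∣+∣q∣ p q
∣p∣≤∣p∩∁q∣+∣q∣ (outside ∷ p) (inside ∷ q)  =
  ℕ.≤-trans (∣p∣≤∣p∩∁q∣+∣q∣ p q) (ℕ.+-monoʳ-≤ ∣ p ∩ ∁ q ∣ (ℕ.n≤1+n ∣ q ∣))
∣p∣≤∣p∩∁q∣+∣q∣ (inside ∷ p)  (outside ∷ q) = s≤s (∣p∣≤∣p∩∁q∣+∣q∣ p q)
∣p∣≤∣p∩∁q∣+∣q∣ (inside ∷ p)  (inside ∷ q)  =
  ℕ.≤-trans (s≤s (∣p∣≤∣p∩∁q∣+∣q∣ p q)) (ℕ.≤-reflexive (sym (ℕ.+-suc ∣ p ∩ ∁ q ∣ ∣ q ∣)))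

∣∁p∣+∣p∣≡n : ∀ {n} (p : Subset n) → ∣ ∁ p ∣ ℕ.+ ∣ p ∣ ≡ n
∣∁p∣+∣p∣≡n p = trans (cong (ℕ._+ ∣ p ∣) (∣∁p∣≡n∸∣p∣ p)) (ℕ.m∸n+n≡m (∣p∣≤n p))

∁-involutive : ∀ {n} (p : Subset n) → ∁ (∁ p) ≡ p
∁-involutive p = ⊆-antisym
  (λ x∈ → x∉∁p⇒x∈p (x∈∁p⇒x∉p x∈)) (λ x∈ → x∉p⇒x∈∁p (x∈p⇒x∉∁p x∈))

-- Parity.

Even : ℕ → Set
Even m = ∃[ k ] m ≡ k ℕ.+ k

-- Source of the 2 in `n - 2`: a matching that is not perfect on an even vertex set misses at least
-- two vertices.
even-gap : ∀ {m n} → Even m → Even n → m ℕ.< n → suc (suc m) ℕ.≤ n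
even-gap (j , refl) (k , refl) j+j<k+k = begin
  suc (suc (j ℕ.+ j))  ≡⟨ cong suc (sym (ℕ.+-suc j j)) ⟩
  suc j ℕ.+ suc j      ≤⟨ ℕ.+-mono-≤ j<k j<k ⟩
  k ℕ.+ k              ∎
  where
  open ℕ.≤-Reasoning
  j<k : j ℕ.< k
  j<k = ℕ.≰⇒> λ k≤j → ℕ.<⇒≱ j+j<k+k (ℕ.+-mono-≤ k≤j k≤j)

even-∸ : ∀ {m n} → n ℕ.≤ m → m % 2 ≡ n % 2 → Even (m ℕ.∸ n)
-- Taking two off an argument leaves its remainder mod 2 definitionally the same, so `eq` is passed
-- on as it is.
even-∸ {m}           {suc (suc n)} (s≤s (s≤s n≤m)) eq = even-∸ n≤m eq
even-∸ {zero}        {zero}        _ _  = 0 , refl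
even-∸ {suc (suc m)} {zero}        _ eq with even-∸ {m} {zero} z≤n eq
... | k , refl = suc k , cong suc (sym (ℕ.+-suc k k))
even-∸ {suc zero}    {suc zero}    _ _  = 0 , refl
even-∸ {suc (suc (suc m))} {suc zero} _ eq with even-∸ {suc m} {suc zero} (s≤s z≤n) eq
... | k , refl = suc k , cong suc (sym (ℕ.+-suc k k))

-- Matchings of induced subgraphs.

module Matchings (G : Graph) where

  open Induced G

  private
    V = Fin (order G)

  -- A matching is given as an involution whose fixed points are the
  -- uncovered vertices.
  record Matching (W : Subset (order G)) (f : V → V) : Set where
    field
      involutive : ∀ v → f (f v) ≡ v
      edge       : ∀ v → f v ≢ v → Edge W v (f v)

  open Matching public

  covered : (V → V) → Subset (order G)
  covered f = tabulate λ v → does (¬? (f v ≟ᶠ v))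

  module _ (f : V → V) where

    ∈-covered⁺ : ∀ {v} → f v ≢ v → v ∈ covered f
    ∈-covered⁺ = ∈-tabulate⁺ λ v → ¬? (f v ≟ᶠ v)

    ∈-covered⁻ : ∀ {v} → v ∈ covered f → f v ≢ v
    ∈-covered⁻ = ∈-tabulate⁻ λ v → ¬? (f v ≟ᶠ v)

    ∉-covered⁻ : ∀ {v} → v ∉ covered f → f v ≡ v
    ∉-covered⁻ {v} v∉ = decidable-stable (f v ≟ᶠ v) (v∉ ∘ ∈-covered⁺)

    covered⊆ : ∀ {W} → Matching W f → covered f ⊆ W
    covered⊆ M v∈ = proj₁ (edge M _ (∈-covered⁻ v∈))

    -- Disjoint and Incident do not depend on the vertex set; ⊤ is arbitrary.
    Pairing : Subset (order G) → Set
    Pairing p = ∃[ es ]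
      All (λ (u , v) → u ∈ p × v ∈ p × v ≡ f u) es × AllPairs (Disjoint ⊤) es ×
      (∀ v → v ∈ p → Any (Incident ⊤ v) es) × ∣ p ∣ ≡ length es ℕ.+ length es

    -- Peel off a vertex `v` with its partner `f v`; as `f` is an involution, the rest is again
    -- closed under `f`. One recursion serves two ends: the edge list becomes a perfect matching,
    -- and the count shows that `covered f` has even size.
    pairing : (∀ v → f (f v) ≡ v) → ∀ p → p ⊆ covered f → (∀ {v} → v ∈ p → f v ∈ p) → Pairing p
    pairing invol p = go p (<-wellFounded ∣ p ∣)
      where
      go : ∀ p → Acc ℕ._<_ ∣ p ∣ → p ⊆ covered f → (∀ {v} → v ∈ p → f v ∈ p) → Pairing p
      go p (acc rec) p⊆ closed with nonempty? p
      ... | no empty = [] , [] , [] , (λ v v∈p → contradiction (v , v∈p) empty) ,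
              trans (cong ∣_∣ (Empty-unique empty)) (∣⊥∣≡0 (order G))
      ... | yes (v , v∈p) = extend (go q
              (rec (ℕ.≤-trans (ℕ.≤-reflexive 1+∣q∣) (∣p─q∣≤∣p∣ p ⁅ v ⁆)))
              (p⊆ ∘ proj₁ ∘ q⁻) q-closed)
        where
        fv≢v = ∈-covered⁻ (p⊆ v∈p)
        q = p - v - f v

        q⁻ : ∀ {x} → x ∈ q → x ∈ p × x ≢ v × x ≢ f v
        q⁻ x∈q with x∈p-y⁻ {p = p - v} x∈q
        ... | x∈p-v , x≢fv with x∈p-y⁻ {p = p} x∈p-v
        ... | x∈p , x≢v = x∈p , x≢v , x≢fv

        q⁺ : ∀ {x} → x ∈ p → x ≢ v → x ≢ f v → x ∈ q
        q⁺ x∈p x≢v x≢fv = x∈p∧x≢y⇒x∈p-y (x∈p∧x≢y⇒x∈p-y x∈p x≢v) x≢fv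

        1+∣q∣ : suc ∣ q ∣ ≡ ∣ p - v ∣
        1+∣q∣ = x∈p⇒1+∣p-x∣≡∣p∣ (x∈p∧x≢y⇒x∈p-y (closed v∈p) fv≢v)

        ∣p∣ : ∣ p ∣ ≡ suc ∣ p - v ∣
        ∣p∣ = sym (x∈p⇒1+∣p-x∣≡∣p∣ v∈p)

        q-closed : ∀ {x} → x ∈ q → f x ∈ q
        q-closed {x} x∈q with q⁻ x∈q
        ... | x∈p , x≢v , x≢fv = q⁺ (closed x∈p)
          (λ fx≡v → x≢fv (trans (sym (invol x)) (cong f fx≡v)))
          (λ fx≡fv → x≢v (trans (sym (invol x)) (trans (cong f fx≡fv) (invol v))))

        extend : Pairing q → Pairing p
        extend (es , areEdges , disjoint , covers , size) =
          (v , f v) ∷ es ,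
          (v∈p , closed v∈p , refl) ∷
            All.map (λ (x∈ , y∈ , eq) → proj₁ (q⁻ x∈) , proj₁ (q⁻ y∈) , eq) areEdges ,
          All.map apart areEdges ∷ disjoint ,
          covers′ ,
          trans ∣p∣ (cong suc (trans (sym 1+∣q∣) (trans (cong suc size)
            (sym (ℕ.+-suc (length es) (length es))))))
          where
          apart : ∀ {e} → proj₁ e ∈ q × proj₂ e ∈ q × proj₂ e ≡ f (proj₁ e) →
                  Disjoint ⊤ (v , f v) e
          apart (x∈ , _ , _) x (inj₁ refl , inj₁ refl) = proj₁ (proj₂ (q⁻ x∈)) refl
          apart (x∈ , _ , _) x (inj₂ refl , inj₁ refl) = proj₂ (proj₂ (q⁻ x∈)) refl
          apart (_ , y∈ , _) x (inj₁ refl , inj₂ refl) = proj₁ (proj₂ (q⁻ y∈)) refl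
          apart (_ , y∈ , _) x (inj₂ refl , inj₂ eq)   = proj₂ (proj₂ (q⁻ y∈)) (sym eq)

          covers′ : ∀ x → x ∈ p → Any (Incident ⊤ x) ((v , f v) ∷ es)
          covers′ x x∈p with x ≟ᶠ v | x ≟ᶠ f v
          ... | yes x≡v | _        = here (inj₁ x≡v)
          ... | no _    | yes x≡fv = here (inj₂ x≡fv)
          ... | no x≢v  | no x≢fv  = there (covers x (q⁺ x∈p x≢v x≢fv))

  covered-cong : ∀ {f g : V → V} → f ≗ g → covered f ≡ covered g
  covered-cong f≗g =
    tabulate-cong λ v → cong (λ w → does (¬? (w ≟ᶠ v))) (f≗g v)

  Matching-cong : ∀ {W} {f g : V → V} → f ≗ g → Matching W f → Matching W g
  Matching-cong {W} {f} {g} f≗g M = record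
    { involutive = λ v → trans (sym (f≗g (g v))) (trans (cong f (sym (f≗g v))) (involutive M v))
    ; edge       = λ v gv≢v →
        subst (Edge W v) (f≗g v) (edge M v (gv≢v ∘ trans (sym (f≗g v))))
    }

  Matching-mono : ∀ {W W′ f} → W ⊆ W′ → Matching W f → Matching W′ f
  Matching-mono W⊆W′ M = record
    { involutive = involutive M
    ; edge       = λ v fv≢v → let u∈ , v∈ , uv = edge M v fv≢v in W⊆W′ u∈ , W⊆W′ v∈ , uv
    }

  matching? : ∀ W → Decidable (Matching W)
  matching? W f = map′
    (λ (i , e) → record { involutive = i ; edge = e })
    (λ M → involutive M , edge M)
    ((all? λ v → f (f v) ≟ᶠ v) ×-dec
     (all? λ v → ¬? (f v ≟ᶠ v) →-dec edge? W v (f v)))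

  -- The search runs over tables of values. A function and its table agree only pointwise, so `P` is
  -- allowed to see just the covered set, which pointwise equality preserves.
  anyMatching? : ∀ W {P : Subset (order G) → Set} → Decidable P →
    Dec (∃[ f ] Matching W f × P (covered f))
  anyMatching? W {P} P? = map′
    (λ (xs , M , p) → lookup xs , M , p)
    (λ (f , M , p) → let f≗ = λ v → sym (lookup∘tabulate f v) in
      tabulate f , Matching-cong f≗ M , subst P (covered-cong f≗) p)
    (anyVec? λ xs → matching? W (lookup xs) ×-dec P? (covered (lookup xs)))

  -- Maximum matchings and edge exchange.

  Maximum : Subset (order G) → (V → V) → Set
  Maximum W f = Matching W f × ∀ g → Matching W g → ∣ covered g ∣ ℕ.≤ ∣ covered f ∣

  emptyMatching : ∀ W → Matching W (λ v → v)
  emptyMatching W = record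
    { involutive = λ _ → refl ; edge = λ v v≢v → contradiction refl v≢v }

  maximumMatching : ∀ W → ∃ (Maximum W)
  maximumMatching W = go _ (emptyMatching W) (<-wellFounded _)
    where
    go : ∀ f → Matching W f → Acc ℕ._<_ (order G ℕ.∸ ∣ covered f ∣) → ∃ (Maximum W)
    go f M (acc rec) with anyMatching? W (λ p → ∣ covered f ∣ ℕ.<? ∣ p ∣)
    ... | yes (g , M′ , <g) = go g M′ (rec (ℕ.∸-monoʳ-< <g (∣p∣≤n (covered g))))
    ... | no none = f , M , λ g M′ → ℕ.≮⇒≥ λ <g → none (g , M′ , <g)

  -- g with the edge xy added and the edge from y to g y, if any, removed.
  rematch : (V → V) → V → V → V → V
  rematch g x y v with v ≟ᶠ x | v ≟ᶠ y | v ≟ᶠ g y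
  ... | yes _ | _     | _     = y
  ... | no _  | yes _ | _     = x
  ... | no _  | no _  | yes _ = v
  ... | no _  | no _  | no _  = g v

  module Rematch {W g} (M : Matching W g) {x y : V}
                 (gx≡x : g x ≡ x) (xy : Edge W x y) where

    x≢y : x ≢ y
    x≢y refl = irrefl G (proj₂ (proj₂ xy))

    x≢gy : x ≢ g y
    x≢gy x≡gy = x≢y (trans (sym gx≡x) (trans (cong g x≡gy) (involutive M y)))

    g′ : V → V
    g′ = rematch g x y

    at-x : g′ x ≡ y
    at-x with x ≟ᶠ x
    ... | yes _  = refl
    ... | no x≢x = contradiction refl x≢x

    at-y : g′ y ≡ x
    at-y with y ≟ᶠ x | y ≟ᶠ y
    ... | yes y≡x | _      = contradiction (sym y≡x) x≢y
    ... | no _    | yes _  = refl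
    ... | no _    | no y≢y = contradiction refl y≢y

    at-gy : g y ≢ y → g′ (g y) ≡ g y
    at-gy gy≢y with g y ≟ᶠ x | g y ≟ᶠ y | g y ≟ᶠ g y
    ... | yes gy≡x | _        | _      = contradiction (sym gy≡x) x≢gy
    ... | no _     | yes gy≡y | _      = contradiction gy≡y gy≢y
    ... | no _     | no _     | yes _  = refl
    ... | no _     | no _     | no ¬eq = contradiction refl ¬eq

    elsewhere : ∀ {v} → v ≢ x → v ≢ y → v ≢ g y → g′ v ≡ g v
    elsewhere {v} v≢x v≢y v≢gy with v ≟ᶠ x | v ≟ᶠ y | v ≟ᶠ g y
    ... | yes v≡x | _       | _        = contradiction v≡x v≢x
    ... | no _    | yes v≡y | _        = contradiction v≡y v≢y
    ... | no _    | no _    | yes v≡gy = contradiction v≡gy v≢gy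
    ... | no _    | no _    | no _     = refl

    data Cases : V → Set where
      is-x  : Cases x
      is-y  : Cases y
      is-gy : g y ≢ y → Cases (g y)
      other : ∀ {v} → v ≢ x → v ≢ y → v ≢ g y → Cases v

    cases : ∀ v → Cases v
    cases v with v ≟ᶠ x | v ≟ᶠ y | v ≟ᶠ g y
    ... | yes refl | _        | _        = is-x
    ... | no _     | yes refl | _        = is-y
    ... | no _     | no v≢y   | yes refl = is-gy v≢y
    ... | no v≢x   | no v≢y   | no v≢gy  = other v≢x v≢y v≢gy

    g-elsewhere : ∀ {v} → v ≢ x → v ≢ y → v ≢ g y → g′ (g v) ≡ g (g v)
    g-elsewhere {v} v≢x v≢y v≢gy = elsewhere
      (λ gv≡x  → v≢x (trans (sym (involutive M v)) (trans (cong g gv≡x) gx≡x)))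
      (λ gv≡y  → v≢gy (trans (sym (involutive M v)) (cong g gv≡y)))
      (λ gv≡gy → v≢y (trans (sym (involutive M v)) (trans (cong g gv≡gy) (involutive M y))))

    isMatching : Matching W g′
    isMatching = record { involutive = invol ; edge = edge′ }
      where
      invol : ∀ v → g′ (g′ v) ≡ v
      invol v with cases v
      ... | is-x  = trans (cong g′ at-x) at-y
      ... | is-y  = trans (cong g′ at-y) at-x
      ... | is-gy gy≢y = trans (cong g′ (at-gy gy≢y)) (at-gy gy≢y)
      ... | other v≢x v≢y v≢gy = trans (cong g′ (elsewhere v≢x v≢y v≢gy))
                (trans (g-elsewhere v≢x v≢y v≢gy) (involutive M v))

      edge′ : ∀ v → g′ v ≢ v → Edge W v (g′ v)
      edge′ v g′v≢v with cases v
      ... | is-x = subst (Edge W x) (sym at-x) xy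
      ... | is-y = subst (Edge W y) (sym at-y)
                     (let x∈ , y∈ , adj = xy in y∈ , x∈ , symm G adj)
      ... | is-gy gy≢y = contradiction (at-gy gy≢y) g′v≢v
      ... | other v≢x v≢y v≢gy = let eq = elsewhere v≢x v≢y v≢gy in
              subst (Edge W v) (sym eq) (edge M v (g′v≢v ∘ trans eq))

    x∈covered : x ∈ covered g′
    x∈covered = ∈-covered⁺ g′ λ g′x≡x → x≢y (trans (sym g′x≡x) at-x)

    x∉covered : x ∉ covered g
    x∉covered x∈ = ∈-covered⁻ g x∈ gx≡x

    -- Here both ends of `xy` are missed by `g`, so the edge is an augmenting path of length one.
    covered-grows : g y ≡ y → covered g ⊂ covered g′
    covered-grows gy≡y = keep , x , x∈covered , x∉covered
      where
      keep : covered g ⊆ covered g′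
      keep {v} v∈ with cases v
      ... | is-x = x∈covered
      ... | is-y = contradiction gy≡y (∈-covered⁻ g v∈)
      ... | is-gy gy≢y = contradiction gy≡y gy≢y
      ... | other v≢x v≢y v≢gy = ∈-covered⁺ g′ λ g′v≡v →
              ∈-covered⁻ g v∈ (trans (sym (elsewhere v≢x v≢y v≢gy)) g′v≡v)

    covered-moves : g y ≢ y → covered g - g y ⊂ covered g′
    covered-moves gy≢y = keep , x , x∈covered , x∉covered ∘ p─q⊆p (covered g) ⁅ g y ⁆
      where
      keep : covered g - g y ⊆ covered g′
      keep {v} v∈- with x∈p-y⁻ {p = covered g} v∈- | cases v
      ... | _ , _ | is-x = x∈covered
      ... | _ , _ | is-y = ∈-covered⁺ g′ λ g′y≡y → x≢y (trans (sym at-y) g′y≡y)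
      ... | _ , v≢gy | is-gy _ = contradiction refl v≢gy
      ... | v∈ , _ | other v≢x v≢y v≢gy = ∈-covered⁺ g′ λ g′v≡v →
              ∈-covered⁻ g v∈ (trans (sym (elsewhere v≢x v≢y v≢gy)) g′v≡v)

    -- The exchange gains `x` and loses at most `g y`, so the number of covered vertices does not
    -- drop.
    isMaximum : g y ≢ y → (∀ h → Matching W h → ∣ covered h ∣ ℕ.≤ ∣ covered g ∣) → Maximum W g′
    isMaximum gy≢y largest = isMatching , λ h M′ → ℕ.≤-trans (largest h M′) (begin
      ∣ covered g ∣            ≡⟨ sym (x∈p⇒1+∣p-x∣≡∣p∣ (∈-covered⁺ g ggy≢gy)) ⟩
      suc ∣ covered g - g y ∣  ≤⟨ p⊂q⇒∣p∣<∣q∣ (covered-moves gy≢y) ⟩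
      ∣ covered g′ ∣           ∎)
      where
      open ℕ.≤-Reasoning
      ggy≢gy : g (g y) ≢ g y
      ggy≢gy eq = gy≢y (sym (trans (sym (involutive M y)) eq))

  -- For `v` in `W`, this is membership in the set D of the Gallai-Edmonds decomposition of the
  -- subgraph induced on `W`.
  Missable : Subset (order G) → V → Set
  Missable W v = ∃[ g ] Maximum W g × g v ≡ v

  -- Gallai's lemma.

  module Gallai (W : Subset (order G)) where

    infix 4 _≈_
    -- Distinct related vertices are never missed together. Adjacent vertices are related, so
    -- transitivity is all that is needed to reach whole components.
    _≈_ : V → V → Set
    u ≈ v = ∀ f → Maximum W f → f u ≡ u → f v ≡ v → u ≡ v

    edge⇒≈ : ∀ {u v} → Edge W u v → u ≈ v
    edge⇒≈ uv f (M , largest) fu≡u fv≡v = contradiction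
      (p⊂q⇒∣p∣<∣q∣ (Rematch.covered-grows M fu≡u uv fv≡v))
      (ℕ.≤⇒≯ (largest _ (Rematch.isMatching M fu≡u uv)))

    agreement : (V → V) → (V → V) → Subset (order G)
    agreement f g = tabulate λ v → does (f v ≟ᶠ g v)

    module _ {u t v} (u≈t : u ≈ t) (t≈v : t ≈ v) (u≢v : u ≢ v)
             {f} (maxᶠ : Maximum W f) (fu≡u : f u ≡ u) (fv≡v : f v ≡ v) where

      private
        Mᶠ = proj₁ maxᶠ

      -- A maximum matching g missing t covers u and v, so some other vertex x
      -- covered by f is missed by g; exchanging the g-edge at f x for the
      -- f-edge at x brings g closer to f.
      exchange : ∀ g → Maximum W g → g t ≡ t →
                 Acc ℕ._<_ (order G ℕ.∸ ∣ agreement f g ∣) → ⊥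
      -- Both `u` and `v` are covered by `g` and not by `f`, while `t` is the only vertex covered by
      -- `f` and not by `g`; so `g` would be larger than the maximum matching `f`.
      exchange g maxᵍ@(Mᵍ , largestᵍ) gt≡t (acc rec) = ℕ.<-irrefl refl (begin-strict
        ∣ covered f ∣                ≤⟨ ∣f∣≤ ⟩
        suc ∣ covered f - t ∣        ≤⟨ s≤s (p⊆q⇒∣p∣≤∣q∣ still) ⟩
        suc ∣ covered g - u - v ∣    ≡⟨ x∈p⇒1+∣p-x∣≡∣p∣ v∈g-u ⟩
        ∣ covered g - u ∣            <⟨ x∈p⇒∣p-x∣<∣p∣ u∈g ⟩
        ∣ covered g ∣                ≤⟨ proj₂ maxᶠ g Mᵍ ⟩
        ∣ covered f ∣                ∎)
        where
        open ℕ.≤-Reasoning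
        u≢t : u ≢ t
        u≢t refl = u≢v (t≈v f maxᶠ fu≡u fv≡v)

        v≢t : v ≢ t
        v≢t refl = u≢v (u≈t f maxᶠ fu≡u fv≡v)

        u∈g : u ∈ covered g
        u∈g = ∈-covered⁺ g λ gu≡u → u≢t (u≈t g maxᵍ gu≡u gt≡t)

        v∈g-u : v ∈ covered g - u
        v∈g-u = x∈p∧x≢y⇒x∈p-y
          (∈-covered⁺ g λ gv≡v → v≢t (sym (t≈v g maxᵍ gt≡t gv≡v))) (u≢v ∘ sym)

        t∈f : t ∈ covered f
        t∈f = ∈-covered⁺ f λ ft≡t → u≢t (u≈t f maxᶠ fu≡u ft≡t)

        ∣f∣≤ : ∣ covered f ∣ ℕ.≤ suc ∣ covered f - t ∣
        ∣f∣≤ = ℕ.≤-reflexive (sym (x∈p⇒1+∣p-x∣≡∣p∣ t∈f))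

        -- Refutes every candidate `x`. If `g` misses `f x` too, the edge augments `g`; otherwise
        -- the exchanged matching still misses `t` and the recursion applies.
        step : ∀ {x} → f x ≢ x → x ≢ t → g x ≢ x
        step {x} fx≢x x≢t gx≡x with g (f x) ≟ᶠ f x
        ... | yes gy≡y = contradiction (p⊂q⇒∣p∣<∣q∣ (R.covered-grows gy≡y))
                           (ℕ.≤⇒≯ (largestᵍ _ R.isMatching))
          where module R = Rematch Mᵍ gx≡x (edge Mᶠ x fx≢x)
        ... | no gy≢y = exchange g′ (R.isMaximum gy≢y largestᵍ)
              (trans (R.elsewhere (x≢t ∘ sym) t≢y t≢gy) gt≡t)
              (rec (ℕ.∸-monoʳ-< (p⊂q⇒∣p∣<∣q∣ closer) (∣p∣≤n (agreement f g′))))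
          where
          module R = Rematch Mᵍ gx≡x (edge Mᶠ x fx≢x)
          g′ = rematch g x (f x)
          t≢y : t ≢ f x
          t≢y refl = gy≢y gt≡t
          t≢gy : t ≢ g (f x)
          t≢gy t≡gy = t≢y (trans (sym gt≡t) (trans (cong g t≡gy) (involutive Mᵍ (f x))))

          agree⁺ : ∀ {h w} → f w ≡ h w → w ∈ agreement f h
          agree⁺ {h} = ∈-tabulate⁺ λ w → f w ≟ᶠ h w
          agree⁻ : ∀ {h w} → w ∈ agreement f h → f w ≡ h w
          agree⁻ {h} = ∈-tabulate⁻ λ w → f w ≟ᶠ h w

          keep : agreement f g ⊆ agreement f g′
          keep {w} w∈ with R.cases w
          ... | R.is-x = agree⁺ (sym R.at-x)
          ... | R.is-y = agree⁺ (trans (involutive Mᶠ x) (sym R.at-y))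
          -- Agreement at `g (f x)` would make `f` send it to `f x`, hence `g (f x)` would be `x`, a
          -- vertex that `g` misses.
          ... | R.is-gy _ = contradiction
                  (trans (sym (involutive Mᶠ x)) (trans
                    (cong f (sym (trans (agree⁻ w∈) (involutive Mᵍ (f x)))))
                    (involutive Mᶠ (g (f x)))))
                  R.x≢gy
          ... | R.other w≢x w≢y w≢gy = agree⁺ (trans (agree⁻ w∈) (sym (R.elsewhere w≢x w≢y w≢gy)))

          closer : agreement f g ⊂ agreement f g′
          closer = keep , x , agree⁺ (sym R.at-x) , λ x∈ → fx≢x (trans (agree⁻ x∈) gx≡x)

        still : covered f - t ⊆ covered g - u - v
        still {x} x∈- with x∈p-y⁻ {p = covered f} x∈-
        ... | x∈ , x≢t = x∈p∧x≢y⇒x∈p-y (x∈p∧x≢y⇒x∈p-y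
                (∈-covered⁺ g (step (∈-covered⁻ f x∈) x≢t))
                (λ { refl → ∈-covered⁻ f x∈ fu≡u })) (λ { refl → ∈-covered⁻ f x∈ fv≡v })

    -- If every maximum matching covered `t`, both relations to `t` would be vacuous and
    -- transitivity could fail. `Missable W t` excludes this and supplies the matching that starts
    -- the exchange.
    ≈-trans : ∀ {u t v} → Missable W t → u ≈ t → t ≈ v → u ≈ v
    ≈-trans {u} {t} {v} (g , maxᵍ , gt≡t) u≈t t≈v f maxᶠ fu≡u fv≡v =
      decidable-stable (u ≟ᶠ v) λ u≢v →
        exchange u≈t t≈v u≢v maxᶠ fu≡u fv≡v g maxᵍ gt≡t (<-wellFounded _)

    reachable⇒≈ : (∀ v → v ∈ W → Missable W v) → ∀ {u v} → Reachable W u v → u ≈ v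
    reachable⇒≈ missable Star.ε = λ _ _ _ _ → refl
    reachable⇒≈ missable (uw@(_ , w∈W , _) ◅ w⇝v) =
      ≈-trans (missable _ w∈W) (edge⇒≈ uw) (reachable⇒≈ missable w⇝v)

  -- Barriers and the Tutte-Berge bound.

  even-covered : ∀ {W f} → Matching W f → Even ∣ covered f ∣
  even-covered {W} {f} M
    with pairing f (involutive M) (covered f) (λ v∈ → v∈)
      (λ v∈ → ∈-covered⁺ f λ ffv≡fv → ∈-covered⁻ f v∈ (sym (trans (sym (involutive M _)) ffv≡fv)))
  ... | es , _ , _ , _ , size = length es , size

  Separated : Subset (order G) → List V → Set
  Separated R xs = All (_∈ R) xs × AllPairs (λ u v → ¬ Reachable R u v) xs

  -- With T = W ∖ R, the inequality says that the separated vertices of W − T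
  -- outnumber T by at least the number of vertices of W that f misses.
  Barrier : Subset (order G) → (V → V) → Set
  Barrier W f = ∃[ R ] R ⊆ W × ∃[ xs ] Separated R xs ×
    ∣ W ∣ ℕ.+ ∣ W ∣ ℕ.≤ length xs ℕ.+ ∣ R ∣ ℕ.+ ∣ covered f ∣

  -- Nothing is deleted: the vertices of `W` missed by `f` are themselves the separated ones, since
  -- Gallai's lemma puts no two of them in one component.
  missable⇒barrier : ∀ {W f} → (∀ v → v ∈ W → Missable W v) → Maximum W f → Barrier W f
  missable⇒barrier {W} {f} missable max with elements (W ∩ ∁ (covered f))
  ... | xs , uniq , xs⊆ , size =
    W , (λ v∈ → v∈) , xs ,
    (All.map (proj₁ ∘ split) xs⊆ , allPairs-zip apart xs⊆ uniq) , (begin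
      ∣ W ∣ ℕ.+ ∣ W ∣
        ≤⟨ ℕ.+-monoˡ-≤ ∣ W ∣ (∣p∣≤∣p∩∁q∣+∣q∣ W (covered f)) ⟩
      ∣ W ∩ ∁ (covered f) ∣ ℕ.+ ∣ covered f ∣ ℕ.+ ∣ W ∣
        ≡⟨ cong (λ l → l ℕ.+ ∣ covered f ∣ ℕ.+ ∣ W ∣) (sym size) ⟩
      length xs ℕ.+ ∣ covered f ∣ ℕ.+ ∣ W ∣
        ≡⟨ solve 3 (λ l c w → l :+ c :+ w := l :+ w :+ c) refl (length xs) ∣ covered f ∣ ∣ W ∣ ⟩
      length xs ℕ.+ ∣ W ∣ ℕ.+ ∣ covered f ∣ ∎)
    where
    open ℕ.≤-Reasoning
    open +-*-Solver
    split : ∀ {v} → v ∈ W ∩ ∁ (covered f) → v ∈ W × f v ≡ v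
    split v∈ with x∈p∩q⁻ W (∁ (covered f)) v∈
    ... | v∈W , v∈∁ = v∈W , ∉-covered⁻ f (x∈∁p⇒x∉p v∈∁)

    apart : ∀ {u v} → u ∈ W ∩ ∁ (covered f) → v ∈ W ∩ ∁ (covered f) → u ≢ v →
            ¬ Reachable W u v
    apart u∈ v∈ u≢v u⇝v = u≢v
      (Gallai.reachable⇒≈ W missable u⇝v f max (proj₂ (split u∈)) (proj₂ (split v∈)))

  tutteBerge : ∀ {W f} → Maximum W f → Barrier W f
  tutteBerge {W} = go W (<-wellFounded _)
    where
    go : ∀ W {f} → Acc ℕ._<_ ∣ W ∣ → Maximum W f → Barrier W f
    go W {f} (acc rec) max@(M , largest)
      -- A matching covering at least as many vertices as `f` is itself maximum, so missability can
      -- be decided by looking at covered sets alone.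
      with any? (λ v → (v ∈? W) ×-dec
        ¬? (anyMatching? W λ p → (∣ covered f ∣ ℕ.≤? ∣ p ∣) ×-dec ¬? (v ∈? p)))
    ... | no none = missable⇒barrier missable max
      where
      missable : ∀ v → v ∈ W → Missable W v
      missable v v∈W
        with anyMatching? W (λ p → (∣ covered f ∣ ℕ.≤? ∣ p ∣) ×-dec ¬? (v ∈? p))
      ... | no never = contradiction (v , v∈W , never) none
      ... | yes (g , Mᵍ , f≤g , v∉) =
        g , (Mᵍ , λ h Mʰ → ℕ.≤-trans (largest h Mʰ) f≤g) , ∉-covered⁻ g v∉
    -- By parity, deleting v costs f at least two covered vertices.
    ... | yes (v , v∈W , always) with maximumMatching (W - v)
    ... | g , maxᵍ@(Mᵍ , _) with go (W - v) (rec (x∈p⇒∣p-x∣<∣p∣ v∈W)) maxᵍ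
    ... | R , R⊆ , xs , separated , bound =
      R , p─q⊆p W ⁅ v ⁆ ∘ R⊆ , xs , separated , (begin
        ∣ W ∣ ℕ.+ ∣ W ∣
          ≡⟨ cong₂ ℕ._+_ ∣W∣ ∣W∣ ⟩
        suc ∣ W - v ∣ ℕ.+ suc ∣ W - v ∣
          ≡⟨ solve 1 (λ w → con 1 :+ w :+ (con 1 :+ w) := con 2 :+ (w :+ w)) refl ∣ W - v ∣ ⟩
        2 ℕ.+ (∣ W - v ∣ ℕ.+ ∣ W - v ∣)
          ≤⟨ ℕ.+-monoʳ-≤ 2 bound ⟩
        2 ℕ.+ (length xs ℕ.+ ∣ R ∣ ℕ.+ ∣ covered g ∣)
          ≡⟨ solve 2 (λ a c → con 2 :+ (a :+ c) := a :+ (con 2 :+ c)) refl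
               (length xs ℕ.+ ∣ R ∣) ∣ covered g ∣ ⟩
        length xs ℕ.+ ∣ R ∣ ℕ.+ (2 ℕ.+ ∣ covered g ∣)
          ≤⟨ ℕ.+-monoʳ-≤ (length xs ℕ.+ ∣ R ∣) (even-gap (even-covered Mᵍ) (even-covered M) g<f) ⟩
        length xs ℕ.+ ∣ R ∣ ℕ.+ ∣ covered f ∣ ∎)
      where
      open ℕ.≤-Reasoning
      open +-*-Solver
      ∣W∣ : ∣ W ∣ ≡ suc ∣ W - v ∣
      ∣W∣ = sym (x∈p⇒1+∣p-x∣≡∣p∣ v∈W)

      g<f : ∣ covered g ∣ ℕ.< ∣ covered f ∣
      g<f = ℕ.≰⇒> λ f≤g → always
        (g , Matching-mono (p─q⊆p W ⁅ v ⁆) Mᵍ , f≤g ,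
         λ v∈ → proj₂ (x∈p-y⁻ {p = W} (covered⊆ g Mᵍ v∈)) refl)

  -- From barriers to cut sets and perfect matchings.

  -- Every vertex lies in its own `component`, so mutually unreachable vertices have distinct ones;
  -- the pigeonhole principle does the rest.
  separated⇒≤#components : ∀ {R xs} → Separated R xs → length xs ℕ.≤ #components R
  separated⇒≤#components {R} {xs} (xs⊆R , apart) = subst (ℕ._≤ #components R)
    (List.length-map (component R) xs)
    (unique⊆⇒length≤
      (AllPairs.map⁺ (AllPairs.map distinct apart))
      (All.map⁺ (All.map (λ {v} v∈R → ∈-deduplicate⁺ (≡-dec Bool._≟_)
        (∈-map⁺ (component R) (∈-filter⁺ (_∈? R) (∈-allFin v) v∈R))) xs⊆R)))
    where
    distinct : ∀ {u v} → ¬ Reachable R u v → component R u ≢ component R v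
    distinct {u} {v} ¬u⇝v eq = ¬u⇝v (∈-tabulate⁻ (star? (edge? R) u)
      (subst (v ∈_) (sym eq) (∈-tabulate⁺ (star? (edge? R) v) Star.ε)))

  separated⇒disconnected : ∀ {R xs} → Separated R xs → 2 ℕ.≤ length xs → ¬ IsConnected R
  separated⇒disconnected {xs = _ ∷ []} _ (s≤s ())
  separated⇒disconnected {xs = u ∷ v ∷ _} (u∈ ∷ v∈ ∷ _ , (¬u⇝v ∷ _) ∷ _) _ conn =
    ¬u⇝v (conn u v u∈ v∈)

  -- As `covered f` lies inside `W`, the size bound forces equality, so `W` is closed under `f` and
  -- can be paired off.
  covers⇒perfect : ∀ {W f} → Matching W f → ∣ W ∣ ℕ.≤ ∣ covered f ∣ → PerfectMatching W
  covers⇒perfect {W} {f} M W≤ with pairing f (involutive M) W W⊆ closed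
    where
    W⊆ : W ⊆ covered f
    W⊆ {v} v∈W = decidable-stable (v ∈? covered f) λ v∉ →
      ℕ.<⇒≱ (p⊂q⇒∣p∣<∣q∣ (covered⊆ f M , v , v∈W , v∉)) W≤
    closed : ∀ {v} → v ∈ W → f v ∈ W
    closed v∈W = proj₁ (proj₂ (edge M _ (∈-covered⁻ f (W⊆ v∈W))))
  ... | es , areEdges , disjoint , covers , _ = record
    { edges    = es
    ; areEdges = All.map toEdge areEdges
    ; disjoint = disjoint
    ; covers   = covers
    }
    where
    toEdge : ∀ {e} → proj₁ e ∈ W × proj₂ e ∈ W × proj₂ e ≡ f (proj₁ e) →
             Edge W (proj₁ e) (proj₂ e)
    toEdge {u , _} (u∈ , v∈ , refl) =
      edge M u λ fu≡u → ℕ.<⇒≱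
        (p⊂q⇒∣p∣<∣q∣ (covered⊆ f M , u , u∈ , λ u∈′ → ∈-covered⁻ f u∈′ fu≡u)) W≤

  -- T is S together with the barrier of G − S.
  perfectMatching⊎cutSet : ∀ S → order G % 2 ≡ ∣ S ∣ % 2 →
    PerfectMatching (∁ S) ⊎
    (∃[ T ] CutSet G T × ∣ T ∣ ℕ.+ 2 ℕ.≤ #components (∁ T) ℕ.+ ∣ S ∣)
  perfectMatching⊎cutSet S parity with maximumMatching (∁ S)
  ... | f , max@(M , _) with ∣ ∁ S ∣ ℕ.≤? ∣ covered f ∣
  ... | yes W≤ = inj₁ (covers⇒perfect M W≤)
  ... | no W≰ with tutteBerge max
  ... | R , R⊆ , xs , separated , bound = inj₂
      (∁ R , subst (λ p → ¬ IsConnected p) (sym (∁-involutive R))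
               (separated⇒disconnected separated 2≤) , (begin
        ∣ ∁ R ∣ ℕ.+ 2
          ≤⟨ gap ⟩
        length xs ℕ.+ ∣ S ∣
          ≤⟨ ℕ.+-monoˡ-≤ ∣ S ∣ (separated⇒≤#components separated) ⟩
        #components R ℕ.+ ∣ S ∣
          ≡⟨ cong (λ p → #components p ℕ.+ ∣ S ∣) (sym (∁-involutive R)) ⟩
        #components (∁ (∁ R)) ℕ.+ ∣ S ∣ ∎))
    where
    open ℕ.≤-Reasoning
    open +-*-Solver
    w = ∣ ∁ S ∣
    r = ∣ R ∣
    l = length xs
    c = ∣ covered f ∣

    even-W : Even w
    even-W = subst Even (sym (∣∁p∣≡n∸∣p∣ S)) (even-∸ (∣p∣≤n S) parity)

    -- By parity `c + 2 ≤ w`, which trades `c` in `bound` for `w - 2`.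
    w+2≤l+r : w ℕ.+ 2 ℕ.≤ l ℕ.+ r
    w+2≤l+r = ℕ.+-cancelʳ-≤ w (w ℕ.+ 2) (l ℕ.+ r) (begin
      w ℕ.+ 2 ℕ.+ w
        ≡⟨ solve 1 (λ w → w :+ con 2 :+ w := w :+ w :+ con 2) refl w ⟩
      w ℕ.+ w ℕ.+ 2
        ≤⟨ ℕ.+-monoˡ-≤ 2 bound ⟩
      l ℕ.+ r ℕ.+ c ℕ.+ 2
        ≡⟨ solve 2 (λ a c → a :+ c :+ con 2 := a :+ (con 2 :+ c)) refl (l ℕ.+ r) c ⟩
      l ℕ.+ r ℕ.+ (2 ℕ.+ c)
        ≤⟨ ℕ.+-monoʳ-≤ (l ℕ.+ r) (even-gap (even-covered M) even-W (ℕ.≰⇒> W≰)) ⟩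
      l ℕ.+ r ℕ.+ w ∎)

    -- Since `R` lies in `∁ S`, `r ≤ w` leaves at least two separated vertices, so `∁ R` is a cut
    -- set even when nothing beyond `S` was deleted.
    2≤ : 2 ℕ.≤ l
    2≤ = ℕ.+-cancelʳ-≤ w 2 l (begin
      2 ℕ.+ w  ≡⟨ ℕ.+-comm 2 w ⟩
      w ℕ.+ 2  ≤⟨ w+2≤l+r ⟩
      l ℕ.+ r  ≤⟨ ℕ.+-monoʳ-≤ l (p⊆q⇒∣p∣≤∣q∣ R⊆) ⟩
      l ℕ.+ w  ∎)

    gap : ∣ ∁ R ∣ ℕ.+ 2 ℕ.≤ l ℕ.+ ∣ S ∣
    gap = ℕ.+-cancelʳ-≤ r _ _ (begin
      ∣ ∁ R ∣ ℕ.+ 2 ℕ.+ r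
        ≡⟨ solve 2 (λ t r → t :+ con 2 :+ r := t :+ r :+ con 2) refl ∣ ∁ R ∣ r ⟩
      ∣ ∁ R ∣ ℕ.+ r ℕ.+ 2
        ≡⟨ cong (ℕ._+ 2) (trans (∣∁p∣+∣p∣≡n R) (sym (∣∁p∣+∣p∣≡n S))) ⟩
      w ℕ.+ ∣ S ∣ ℕ.+ 2
        ≡⟨ solve 2 (λ w s → w :+ s :+ con 2 := w :+ con 2 :+ s) refl w ∣ S ∣ ⟩
      w ℕ.+ 2 ℕ.+ ∣ S ∣
        ≤⟨ ℕ.+-monoˡ-≤ ∣ S ∣ w+2≤l+r ⟩
      l ℕ.+ r ℕ.+ ∣ S ∣
        ≡⟨ solve 3 (λ l r s → l :+ r :+ s := l :+ s :+ r) refl l r ∣ S ∣ ⟩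
      l ℕ.+ ∣ S ∣ ℕ.+ r ∎)

-- Connectivity and toughness as minima.

∈-subsets : ∀ {n} (p : Subset n) → p ∈ₗ subsets n
∈-subsets []            = here refl
∈-subsets (outside ∷ p) = ∈-++⁺ˡ (∈-map⁺ (outside ∷_) (∈-subsets p))
∈-subsets (inside ∷ p)  = ∈-++⁺ʳ _ (∈-map⁺ (inside ∷_) (∈-subsets p))

∈-toList : ∀ {A : Set} {P : A → Set} {x xs} (pxs : All P xs) → x ∈ₗ xs →
  ∃[ px ] (x , px) ∈ₗ All.toList pxs
∈-toList (px ∷ pxs) (here refl)  = px , here refl
∈-toList (px ∷ pxs) (there x∈xs) with ∈-toList pxs x∈xs
... | py , y∈ = py , there y∈

module _ {b ℓ₁ ℓ₂} (O : TotalOrder b ℓ₁ ℓ₂) where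

  open TotalOrder O using (Carrier) renaming (_≤_ to _≼_)

  -- The list pairs `S` with the proof found by `all-filter`, not with `p`; hence the hypothesis
  -- that `f` ignores the proof.
  min-subsets≤ : ∀ {n} {P : Subset n → Set} (P? : Decidable P) (f : ∃ P → Carrier) →
    (∀ {S} (p q : P S) → f (S , p) ≡ f (S , q)) → ∀ b {S} (p : P S) →
    min O b (List.map f (All.toList (All.all-filter P? (subsets n)))) ≼ f (S , p)
  min-subsets≤ {n} P? f f-irr b {S} p
    with ∈-toList (All.all-filter P? (subsets n)) (∈-filter⁺ P? (∈-subsets S) p)
  ... | q , S∈ = subst (m ≼_) (f-irr q p)
    (All.lookup (min≤xs O b _) (∈-map⁺ f S∈))
    where m = min O b (List.map f (All.toList (All.all-filter P? (subsets n))))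

cutSet⇒2≤∣∁S∣ : ∀ G {S} → CutSet G S → 2 ℕ.≤ ∣ ∁ S ∣
cutSet⇒2≤∣∁S∣ G {S} cut = ℕ.≰⇒> λ ∣∁S∣≤1 → cut (connected ∣∁S∣≤1)
  where
  open ℕ.≤-Reasoning
  connected : ∣ ∁ S ∣ ℕ.≤ 1 → Induced.IsConnected G (∁ S)
  connected ∣∁S∣≤1 u v u∈ v∈ with u ≟ᶠ v
  ... | yes refl = Star.ε
  ... | no u≢v   = contradiction ∣∁S∣≤1 (ℕ.<⇒≱ (begin
    2                      ≤⟨ s≤s (ℕ.≤-trans (s≤s z≤n) (x∈p⇒∣p-x∣<∣p∣ v∈-u)) ⟩
    suc ∣ ∁ S - u ∣        ≡⟨ x∈p⇒1+∣p-x∣≡∣p∣ u∈ ⟩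
    ∣ ∁ S ∣                ∎))
    where
    v∈-u : v ∈ ∁ S - u
    v∈-u = x∈p∧x≢y⇒x∈p-y v∈ (u≢v ∘ sym)

κ≤ : ∀ G {S} → CutSet G S → κ G ℕ.≤ ∣ S ∣
κ≤ G cut = min-subsets≤ ℕ.≤-totalOrder (separates? G) (λ (S , _) → ∣ S ∣)
  (λ _ _ → refl) _ (inj₁ cut)

toughness≤ : ∀ G nc {S} (cut : CutSet G S) → toughness G nc ℚ.≤ ratio G (S , cut)
-- `refl` works because the cut-set proof enters `ratio` only through the irrelevant non-zero
-- instance of the division.
toughness≤ G nc cut = min-subsets≤
  (DecTotalOrder.totalOrder ℚ.≤-decTotalOrder) (cutSet? G) (ratio G) (λ _ _ → refl) _ cut

-- Removing a cut set leaves at least two vertices. Together with `n≤1+k` this gives `n < order G`.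
κ+2≤order : ∀ G → ¬ Complete G → κ G ℕ.+ 2 ℕ.≤ order G
κ+2≤order G nc with nonComplete⇒cutSet G nc
... | S , cut = begin
  κ G ℕ.+ 2          ≤⟨ ℕ.+-mono-≤ (κ≤ G cut) (cutSet⇒2≤∣∁S∣ G cut) ⟩
  ∣ S ∣ ℕ.+ ∣ ∁ S ∣  ≡⟨ ℕ.+-comm ∣ S ∣ ∣ ∁ S ∣ ⟩
  ∣ ∁ S ∣ ℕ.+ ∣ S ∣  ≡⟨ ∣∁p∣+∣p∣≡n S ⟩
  order G            ∎
  where open ℕ.≤-Reasoning

-- The toughness estimate over the rationals.

toℚᵘ-/ : ∀ i d → toℚᵘ (i ℚ./ suc d) ℚᵘ.≃ mkℚᵘ i d
toℚᵘ-/ i d = ℚ.toℚᵘ-fromℚᵘ (mkℚᵘ i d)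

/1-mono-≤ : ∀ {i j} → i ℤ.≤ j → i ℚ./ 1 ℚ.≤ j ℚ./ 1
/1-mono-≤ {i} {j} i≤j = ℚ.toℚᵘ-cancel-≤ (begin
  toℚᵘ (i ℚ./ 1)  ≃⟨ toℚᵘ-/ i 0 ⟩
  mkℚᵘ i 0        ≤⟨ *≤* (ℤ.*-monoʳ-≤-nonNeg (+ 1) i≤j) ⟩
  mkℚᵘ j 0        ≃⟨ ℚᵘ.≃-sym (toℚᵘ-/ j 0) ⟩
  toℚᵘ (j ℚ./ 1)  ∎)
  where open ℚᵘ.≤-Reasoning

/1-homo-+ : ∀ i j → (i ℤ.+ j) ℚ./ 1 ≡ i ℚ./ 1 ℚ.+ j ℚ./ 1
/1-homo-+ i j = ℚ.toℚᵘ-injective (begin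
  toℚᵘ ((i ℤ.+ j) ℚ./ 1)              ≈⟨ toℚᵘ-/ (i ℤ.+ j) 0 ⟩
  mkℚᵘ (i ℤ.+ j) 0                    ≈⟨ *≡* (cong (ℤ._* + 1)
    (cong₂ ℤ._+_ (sym (ℤ.*-identityʳ i)) (sym (ℤ.*-identityʳ j)))) ⟩
  mkℚᵘ i 0 ℚᵘ.+ mkℚᵘ j 0              ≈⟨ ℚᵘ.+-cong (ℚᵘ.≃-sym (toℚᵘ-/ i 0)) (ℚᵘ.≃-sym (toℚᵘ-/ j 0)) ⟩
  toℚᵘ (i ℚ./ 1) ℚᵘ.+ toℚᵘ (j ℚ./ 1)  ≈⟨ ℚᵘ.≃-sym (ℚ.toℚᵘ-homo-+ (i ℚ./ 1) (j ℚ./ 1)) ⟩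
  toℚᵘ (i ℚ./ 1 ℚ.+ j ℚ./ 1)          ∎)
  where open ℚᵘ.≃-Reasoning

/-*-cancel : ∀ i d .{{_ : ℕ.NonZero d}} → i ℚ./ d ℚ.* (+ d ℚ./ 1) ≡ i ℚ./ 1
/-*-cancel i (suc d) = ℚ.toℚᵘ-injective (begin
  toℚᵘ (i ℚ./ suc d ℚ.* (+ suc d ℚ./ 1))         ≈⟨ ℚ.toℚᵘ-homo-* (i ℚ./ suc d) (+ suc d ℚ./ 1) ⟩
  toℚᵘ (i ℚ./ suc d) ℚᵘ.* toℚᵘ (+ suc d ℚ./ 1)   ≈⟨ ℚᵘ.*-cong (toℚᵘ-/ i d) (toℚᵘ-/ (+ suc d) 0) ⟩
  mkℚᵘ i d ℚᵘ.* mkℚᵘ (+ suc d) 0                 ≈⟨ *≡* (trans (ℤ.*-identityʳ (i ℤ.* + suc d))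
    (cong (λ k → i ℤ.* + suc k) (sym (ℕ.*-identityʳ d)))) ⟩
  mkℚᵘ i 0                                       ≈⟨ ℚᵘ.≃-sym (toℚᵘ-/ i 0) ⟩
  toℚᵘ (i ℚ./ 1)                                 ∎)
  where open ℚᵘ.≃-Reasoning

+-cancelʳ-≤ : ∀ r {p q} → p ℚ.+ r ℚ.≤ q ℚ.+ r → p ℚ.≤ q
+-cancelʳ-≤ r {p} {q} le =
  subst₂ ℚ._≤_ (undo p) (undo q) (ℚ.+-monoˡ-≤ (ℚ.- r) le)
  where
  open ℚSolver
  undo : ∀ p → p ℚ.+ r ℚ.- r ≡ p
  undo p = solve 2 (λ p r → p :+ r :- r := p) refl p r

-- Here `a` is n - 2, `k` is κ(G), `e` is one term of the sequence for ε, and `δ` is the margin in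
-- the bound on κ(G).
module _ {a k e δ} (e>0 : 0ℚ ℚ.< e)
         (κ-bound : (a ℚ.* (1ℚ ℚ.+ e)) ℚ.* inv e ℚ.+ δ ℚ.≤ k) where

  open ℚ.≤-Reasoning
  open ℚSolver

  private
    instance
      e-pos : ℚ.Positive e
      e-pos = ℚ.positive e>0

      e-nonNeg : ℚ.NonNegative e
      e-nonNeg = ℚ.nonNegative (ℚ.<⇒≤ e>0)

  κ-bound′ : a ℚ.* (1ℚ ℚ.+ e) ℚ.+ δ ℚ.* e ℚ.≤ k ℚ.* e
  κ-bound′ = begin
    x ℚ.+ δ ℚ.* e                    ≡⟨ cong (ℚ._+ δ ℚ.* e) (sym (*-cancel-inv e>0 x)) ⟩
    e ℚ.* (x ℚ.* inv e) ℚ.+ δ ℚ.* e  ≡⟨ solve 3 (λ e y d → e :* y :+ d :* e := (y :+ d) :* e)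
                                          refl e (x ℚ.* inv e) δ ⟩
    (x ℚ.* inv e ℚ.+ δ) ℚ.* e        ≤⟨ ℚ.*-monoʳ-≤-nonNeg e κ-bound ⟩
    k ℚ.* e                          ∎
    where x = a ℚ.* (1ℚ ℚ.+ e)

  -- From `k ≤ a`, `κ-bound′` would leave `a + δ * e ≤ 0`, although `0 ≤ k ≤ a`.
  k≰a : 0ℚ ℚ.< δ → 0ℚ ℚ.≤ k → ¬ k ℚ.≤ a
  k≰a δ>0 k≥0 k≤a = ℚ.<-irrefl refl (begin-strict
    k ℚ.* e                                  ≤⟨ ℚ.*-monoʳ-≤-nonNeg e k≤a ⟩
    a ℚ.* e                                  ≡⟨ sym (ℚ.+-identityˡ (a ℚ.* e)) ⟩
    0ℚ ℚ.+ a ℚ.* e                           <⟨ ℚ.+-monoˡ-< (a ℚ.* e)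
      (ℚ.+-mono-≤-< (ℚ.≤-trans k≥0 k≤a) (*-pos δ>0 e>0)) ⟩
    a ℚ.+ δ ℚ.* e ℚ.+ a ℚ.* e                ≡⟨ solve 3 (λ a d e →
      a :+ d :* e :+ a :* e := a :* (con 1ℚ :+ e) :+ d :* e) refl a δ e ⟩
    a ℚ.* (1ℚ ℚ.+ e) ℚ.+ δ ℚ.* e             ≤⟨ κ-bound′ ⟩
    k ℚ.* e                                  ∎)

  -- Add `s * e` to both sides. Then `s ≤ c + a` splits off `c * (1 + e)`, and `κ-bound′` absorbs
  -- the remainder into `k * e ≤ s * e`. The sign of `a` is free, which covers `n = 1`.
  s+δe≤c[1+e] : ∀ {s c} → k ℚ.≤ s → s ℚ.≤ c ℚ.+ a → s ℚ.+ δ ℚ.* e ℚ.≤ c ℚ.* (1ℚ ℚ.+ e)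
  s+δe≤c[1+e] {s} {c} k≤s s≤c+a = +-cancelʳ-≤ (s ℚ.* e) (begin
    s ℚ.+ δ ℚ.* e ℚ.+ s ℚ.* e
      ≡⟨ solve 3 (λ s d e → s :+ d :* e :+ s :* e := s :* (con 1ℚ :+ e) :+ d :* e) refl s δ e ⟩
    s ℚ.* (1ℚ ℚ.+ e) ℚ.+ δ ℚ.* e
      ≤⟨ ℚ.+-monoˡ-≤ (δ ℚ.* e) (ℚ.*-monoʳ-≤-nonNeg (1ℚ ℚ.+ e) {{1+e≥0}} s≤c+a) ⟩
    (c ℚ.+ a) ℚ.* (1ℚ ℚ.+ e) ℚ.+ δ ℚ.* e
      ≡⟨ solve 4 (λ c a d e → (c :+ a) :* (con 1ℚ :+ e) :+ d :* e :=
           c :* (con 1ℚ :+ e) :+ (a :* (con 1ℚ :+ e) :+ d :* e)) refl c a δ e ⟩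
    c ℚ.* (1ℚ ℚ.+ e) ℚ.+ (a ℚ.* (1ℚ ℚ.+ e) ℚ.+ δ ℚ.* e)
      ≤⟨ ℚ.+-monoʳ-≤ (c ℚ.* (1ℚ ℚ.+ e)) (ℚ.≤-trans κ-bound′ (ℚ.*-monoʳ-≤-nonNeg e k≤s)) ⟩
    c ℚ.* (1ℚ ℚ.+ e) ℚ.+ s ℚ.* e ∎)
    where
    1+e≥0 : ℚ.NonNegative (1ℚ ℚ.+ e)
    1+e≥0 = ℚ.nonNeg+nonNeg⇒nonNeg 1ℚ e

  -- A strict inequality of reals needs one margin for all late indices, so the varying `e` in
  -- `δ * e` gives way to its lower bound `δ₀` before dividing by `c`.
  ratio+gap≤1+e : ∀ {s c r δ₀} → k ℚ.≤ s → s ℚ.≤ c ℚ.+ a → 0ℚ ℚ.< c → r ℚ.* c ≡ s →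
    0ℚ ℚ.< δ → δ₀ ℚ.≤ e → r ℚ.+ δ ℚ.* δ₀ ℚ.* inv c ℚ.≤ 1ℚ ℚ.+ e
  ratio+gap≤1+e {s} {c} {r} {δ₀} k≤s s≤c+a c>0 rc≡s δ>0 δ₀≤e =
    ℚ.*-cancelʳ-≤-pos c {{ℚ.positive c>0}} (begin
    (r ℚ.+ δ ℚ.* δ₀ ℚ.* inv c) ℚ.* c
      ≡⟨ solve 3 (λ r y c → (r :+ y) :* c := r :* c :+ c :* y) refl r (δ ℚ.* δ₀ ℚ.* inv c) c ⟩
    r ℚ.* c ℚ.+ c ℚ.* (δ ℚ.* δ₀ ℚ.* inv c)
      ≡⟨ cong₂ ℚ._+_ rc≡s (*-cancel-inv c>0 (δ ℚ.* δ₀)) ⟩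
    s ℚ.+ δ ℚ.* δ₀
      ≤⟨ ℚ.+-monoʳ-≤ s (ℚ.*-monoˡ-≤-nonNeg δ {{ℚ.nonNegative (ℚ.<⇒≤ δ>0)}} δ₀≤e) ⟩
    s ℚ.+ δ ℚ.* e
      ≤⟨ s+δe≤c[1+e] {c = c} k≤s s≤c+a ⟩
    c ℚ.* (1ℚ ℚ.+ e)
      ≡⟨ ℚ.*-comm c (1ℚ ℚ.+ e) ⟩
    (1ℚ ℚ.+ e) ℚ.* c ∎)

-- Integers are used because `n - 2` is negative at `n = 1`.
s+2≤c+n⇒s≤c+[n-2] : ∀ {s n} c → s ℕ.+ 2 ℕ.≤ c ℕ.+ n → + s ℤ.≤ + c ℤ.+ (+ n ℤ.- + 2)
s+2≤c+n⇒s≤c+[n-2] {s} {n} c le = subst₂ ℤ._≤_ lhs rhs (ℤ.+-monoˡ-≤ (ℤ.- + 2) (ℤ.+≤+ le))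
  where
  open ℤ.+-*-Solver
  lhs : + (s ℕ.+ 2) ℤ.- + 2 ≡ + s
  lhs = trans (cong (ℤ._- + 2) (ℤ.pos-+ s 2))
    (solve 1 (λ s → s :+ con (+ 2) :- con (+ 2) := s) refl (+ s))
  rhs : + (c ℕ.+ n) ℤ.- + 2 ≡ + c ℤ.+ (+ n ℤ.- + 2)
  rhs = trans (cong (ℤ._- + 2) (ℤ.pos-+ c n)) (ℤ.+-assoc (+ c) (+ n) (ℤ.- + 2))

-- From the real hypotheses to factor-criticality.

module _ (n k : ℕ) (ε : ℝ) (ε>0 : ε > 0ℝ)
         (large : fromℕ k > (fromℤ (+ n ℤ.- + 2) * (1ℝ + ε)) / ε ⟨ ε>0 ⟩) where

  private
    a = (+ n ℤ.- + 2) ℚ./ 1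

    eventually : ∃[ δ₀ ] 0ℚ ℚ.< δ₀ × ∃[ δ ] 0ℚ ℚ.< δ × ∃[ N ] ∀ m → N ℕ.≤ m →
      δ₀ ℚ.≤ seq ε m ×
      (a ℚ.* (1ℚ ℚ.+ seq ε m)) ℚ.* inv (seq ε m) ℚ.+ δ ℚ.≤ + k ℚ./ 1
    eventually =
      let δ₀ , δ₀>0 , M , ε≥ = ε>0
          δ , δ>0 , N , bound = large
      in δ₀ , δ₀>0 , δ , δ>0 , M ℕ.⊔ N , λ m ≤m →
        subst (ℚ._≤ seq ε m) (ℚ.+-identityˡ δ₀) (ε≥ m (ℕ.m⊔n≤o⇒m≤o M N ≤m)) ,
        bound m (ℕ.m⊔n≤o⇒n≤o M N ≤m)

  n≤1+k : n ℕ.≤ suc k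
  n≤1+k with eventually
  ... | δ₀ , δ₀>0 , δ , δ>0 , N , bound with bound N ℕ.≤-refl
  ... | δ₀≤e , k-bound = ℕ.≮⇒≥ λ k+1<n →
    k≰a (ℚ.<-≤-trans δ₀>0 δ₀≤e) k-bound δ>0
      (/1-mono-≤ {+ 0} {+ k} (ℤ.+≤+ z≤n))
      -- Taking `c = 0` turns `k + 2 ≤ n` into `k ≤ n - 2`.
      (/1-mono-≤ (subst (+ k ℤ.≤_) (ℤ.+-identityˡ (+ n ℤ.- + 2))
        (s+2≤c+n⇒s≤c+[n-2] 0 (subst (ℕ._≤ n) (ℕ.+-comm 2 k) k+1<n))))

  quotient<1+ε : ∀ {t} s c .{{_ : ℕ.NonZero c}} → k ℕ.≤ s → s ℕ.+ 2 ℕ.≤ c ℕ.+ n →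
    t ℚ.≤ + s ℚ./ c → fromℚ t < 1ℝ + ε
  quotient<1+ε {t} s c k≤s size t≤s/c with eventually
  ... | δ₀ , δ₀>0 , δ , δ>0 , N , bound =
    δ ℚ.* δ₀ ℚ.* inv q , *-pos (*-pos δ>0 δ₀>0) (inv>0 q>0) , N , λ m N≤m →
      let δ₀≤e , k-bound = bound m N≤m in ℚ.≤-trans
        (ℚ.+-monoˡ-≤ (δ ℚ.* δ₀ ℚ.* inv q) t≤s/c)
        (ratio+gap≤1+e (ℚ.<-≤-trans δ₀>0 δ₀≤e) k-bound {r = + s ℚ./ c}
          (/1-mono-≤ (ℤ.+≤+ k≤s)) s≤c+a q>0 (/-*-cancel (+ s) c) δ>0 δ₀≤e)
    where
    q = + c ℚ./ 1
    q>0 : 0ℚ ℚ.< q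
    q>0 = ℚ.positive⁻¹ q {{ℚ.normalize-pos c 1}}
    s≤c+a : + s ℚ./ 1 ℚ.≤ q ℚ.+ a
    s≤c+a = subst (+ s ℚ./ 1 ℚ.≤_) (/1-homo-+ (+ c) (+ n ℤ.- + 2))
      (/1-mono-≤ (s+2≤c+n⇒s≤c+[n-2] c size))

theorem3p1 : (n : ℕ) → 1 ℕ.≤ n →
    (ε : ℝ) (ε>0 : ε > 0ℝ) →
    (G : Graph) → Connected G → (nc : ¬ Complete G) →
    fromℚ (toughness G nc) ≥ 1ℝ + ε →
    order G % 2 ≡ n % 2 →
    fromℕ (κ G) > (fromℤ (+ n ℤ.- + 2) * (1ℝ + ε)) / ε ⟨ ε>0 ⟩ →
    FactorCritical G n
theorem3p1 n _ ε ε>0 G _ nc tough parity κ-large = n+2≤order , parity , matched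
  where
  n<order : n ℕ.< order G
  n<order = begin
    suc n      ≤⟨ s≤s (n≤1+k n (κ G) ε ε>0 κ-large) ⟩
    2 ℕ.+ κ G  ≡⟨ ℕ.+-comm 2 (κ G) ⟩
    κ G ℕ.+ 2  ≤⟨ κ+2≤order G nc ⟩
    order G    ∎
    where open ℕ.≤-Reasoning

  n+2≤order : n ℕ.+ 2 ℕ.≤ order G
  n+2≤order = begin
    n ℕ.+ 2
      -- The difference `order G - n` is even and positive, hence at least 2.
      ≤⟨ ℕ.+-monoʳ-≤ n (even-gap (0 , refl) (even-∸ (ℕ.<⇒≤ n<order) parity)
           (ℕ.m<n⇒0<n∸m n<order)) ⟩
    n ℕ.+ (order G ℕ.∸ n)
      ≡⟨ ℕ.m+[n∸m]≡n (ℕ.<⇒≤ n<order) ⟩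
    order G ∎
    where open ℕ.≤-Reasoning

  impossible : ∀ {T} → CutSet G T → ¬ ∣ T ∣ ℕ.+ 2 ℕ.≤ Induced.#components G (∁ T) ℕ.+ n
  -- `≥` on `ℝ` is a negated `<`, so `tough` applies directly to the strict inequality it excludes.
  impossible {T} cut size = tough
    (quotient<1+ε n (κ G) ε ε>0 κ-large ∣ T ∣ (Induced.#components G (∁ T))
      {{Induced.disconnected⇒#components≢0 G (∁ T) cut}}
      (κ≤ G cut) size (toughness≤ G nc cut))

  matched : ∀ S → ∣ S ∣ ≡ n → Induced.PerfectMatching G (∁ S)
  matched S refl =
    [ id , (λ (T , cut , size) → contradiction size (impossible cut)) ]′
    (Matchings.perfectMatching⊎cutSet G S parity)
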